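{- For every non-negative integer $M$, $$\sum_{m,n\geq 0} \frac{q^{Q(m,n)-2m-3n}(q^3;q^3)_M}{(q;q)_m (q^3;q^3)_n(q^3;q^3)_{M-2n-m}}(1+q^{3M}) = \sum_{j=-M}^M q^{3j^2-2j}(1+q^{3j}) {2M\brack M+j}_{q^3},$$ where $Q(m,n)=2m^2+6mn+6n^2$.
   Context: $(a;p)_n=\prod_{i=0}^{n-1}(1-ap^i)$ for $n\ge 0$; $1/(p;p)_k=0$ for negative $k$. ${m+n\brack m}_p=\frac{(p;p)_{m+n}}{(p;p)_m(p;p)_n}$ for $m,n\ge0$ and $0$ otherwise. -}

module Defs where

open import Data.Nat as ℕ using (ℕ; zero; suc; _∸_)
open import Data.Nat.Divisibility using (_∣?_)
open import Data.Integer as ℤ using (ℤ; +_; _⊖_; ∣_∣)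
open import Data.List using (List; []; _∷_; map; upTo; foldr)
open import Data.Bool using (if_then_else_)
open import Relation.Nullary.Decidable using (⌊_⌋)
open import Relation.Binary.PropositionalEquality using (_≡_)

-- Formal power series in q with integer coefficients: ℤ[[q]].
PS : Set
PS = ℕ → ℤ

sumℤ : List ℤ → ℤ
sumℤ = foldr ℤ._+_ (+ 0)

infixl 6 _⊕_ _⊖ₛ_
infixl 7 _⊗_

_⊕_ : PS → PS → PS
(f ⊕ g) n = f n ℤ.+ g n

_⊖ₛ_ : PS → PS → PS
(f ⊖ₛ g) n = f n ℤ.- g n

_⊗_ : PS → PS → PS
(f ⊗ g) n = sumℤ (map (λ i → f i ℤ.* g (n ∸ i)) (upTo (suc n)))

zeroS : PS
zeroS _ = + 0

qpow : ℕ → PS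
qpow zero zero = + 1
qpow zero (suc _) = + 0
qpow (suc k) zero = + 0
qpow (suc k) (suc n) = qpow k n

oneS : PS
oneS = qpow 0

-- 1/(1 - q^k) as a power series (only used with k ≥ 1)
geomInv : ℕ → PS
geomInv k n = if ⌊ k ∣? n ⌋ then + 1 else + 0

poch : ℕ → ℕ → PS
poch d zero = oneS
poch d (suc n) = poch d n ⊗ (oneS ⊖ₛ qpow (d ℕ.* suc n))

invPochℕ : ℕ → ℕ → PS
invPochℕ d zero = oneS
invPochℕ d (suc n) = invPochℕ d n ⊗ geomInv (d ℕ.* suc n)

invPoch : ℕ → ℤ → PS
invPoch d (+ n) = invPochℕ d n
invPoch d ℤ.-[1+ n ] = zeroS

-- Gaussian binomial [m+n choose m]_{q^d} for integer m, n (0 unless m,n ≥ 0)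
gauss : ℕ → ℤ → ℤ → PS
gauss d (+ m) (+ n) = poch d (m ℕ.+ n) ⊗ invPochℕ d m ⊗ invPochℕ d n
gauss d (+ m) ℤ.-[1+ n ] = zeroS
gauss d ℤ.-[1+ m ] _ = zeroS

sumS : List PS → PS
sumS = foldr _⊕_ zeroS

-- Q(m,n) - 2m - 3n = 2m² + 6mn + 6n² - 2m - 3n (always ≥ 0)
expL : ℕ → ℕ → ℕ
expL m n = (2 ℕ.* m ℕ.* m ℕ.+ 6 ℕ.* m ℕ.* n ℕ.+ 6 ℕ.* n ℕ.* n) ∸ (2 ℕ.* m ℕ.+ 3 ℕ.* n)

lhsTerm : ℕ → ℕ → ℕ → PS
lhsTerm M m n =
  qpow (expL m n) ⊗ poch 3 M ⊗ invPochℕ 1 m ⊗ invPochℕ 3 n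
    ⊗ invPoch 3 (+ M ℤ.- + (2 ℕ.* n) ℤ.- + m)

-- Sum over m,n ≥ 0. Terms with m > M or n > M vanish (M-2n-m < 0),
-- so summing over 0 ≤ m,n ≤ M gives the full sum.
LHS : ℕ → PS
LHS M = sumS (map (λ n → sumS (map (λ m → lhsTerm M m n) (upTo (suc M)))) (upTo (suc M)))
        ⊗ (oneS ⊕ qpow (3 ℕ.* M))

-- 3j² - 2j for an integer j (always ≥ 0), as a natural number
expR : ℤ → ℕ
expR j = ∣ + 3 ℤ.* j ℤ.* j ℤ.- + 2 ℤ.* j ∣

-- 3j² + j (always ≥ 0): q^{3j²-2j}·q^{3j}; note q^{3j²-2j}(1+q^{3j}) = q^{3j²-2j} + q^{3j²+j}
expR' : ℤ → ℕ
expR' j = ∣ + 3 ℤ.* j ℤ.* j ℤ.+ j ∣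

RHS : ℕ → PS
RHS M = sumS (map (λ i → let j = i ⊖ M in
          (qpow (expR j) ⊕ qpow (expR' j)) ⊗ gauss 3 (+ M ℤ.+ j) (+ M ℤ.- j))
        (upTo (suc (2 ℕ.* M))))

{-# OPTIONS --safe #-}
module Submission where

-- Write p = q³, tri n = n(n-1)/2 and E_u(y) = (-u y; p)_∞ = Σ p^(tri n) uⁿ yⁿ / (p;p)_n.
-- Applying the q-Vandermonde sum twice to [2M choose M+j]_p, and then resolving the factor
-- p^(-ab) / ((p;p)_a (p;p)_b) into a sum over the overlap of a and b, turns
-- Σ_j p^(j²) z^j [2M choose M+j]_p into
--   Σ_L (p;p)_M / (p;p)_{M-L} p^(tri L) [y^L] E_{pz}(y) E_{p/z}(y) E_p(y) / (p y²; p)_∞.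
-- The right-hand side is the sum of the cases (pz, p/z) = (q, q⁵) and (q⁴, q²). On the left,
-- E_1 E_q E_{q²} = (-y; q)_∞, so the double sum is the same expression with the product replaced by
-- g(y) = (-y; q)_∞ / (y²; p)_∞, and multiplying it by 1 + p^M replaces g(y) by
-- g(y) + g(p y) - y g(y). The theorem thus reduces to
--   g(y) + g(p y) - y g(y) = (E_q E_{q⁵} + E_{q⁴} E_{q²}) E_p / (p y²; p)_∞,
-- which after division by E_p E_{q⁴} E_{q⁵} / (p y²; p)_∞ reads
-- (1 + q y)(1 + q² y) + (1 - p y²) = (1 + q y) + (1 + q² y).

open import Defs
open import Algebra using (CommutativeRing)
open import Data.Empty using (⊥-elim)
open import Data.Integer as ℤ using (ℤ; +_; _⊖_)
import Data.Integer.Properties as ℤₚ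
import Data.Integer.Solver as ℤ-Solver
open import Data.List using (foldr; map; upTo; applyUpTo)
open import Data.Nat as ℕ using (ℕ; zero; suc; _∸_; z≤n; s≤s)
open import Data.Nat.Divisibility using (_∣_; _∣?_; _∣0; ∣m+n∣m⇒∣n; ∣m∣n⇒∣m+n; ∣-refl; ∣⇒≤)
import Data.Nat.Properties as ℕₚ
open import Data.Nat.Solver using (module +-*-Solver)
open import Data.Product using (_,_)
open import Function using (id; _∘_)
open import Relation.Binary.PropositionalEquality as ≡ using (_≡_)
open import Relation.Nullary using (yes; no)

-- Sums over antidiagonals and power series

-- The exponent on the left equals 3 tri(2n+m) + tri(m). With L = 2n+m, a term is therefore p^(tri
-- L) / (p;p)_{M-L} times factors in which M enters only through (p;p)_M. Both sides thus become one
-- linear functional of a series in y, and the equation left to prove between such series does not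
-- involve M. The parameters come from 3j²-2j and 3j²+j, that is z = q^(-2) and z = q. In both cases
-- the product of pz and p/z is p², which is why the two products share the denominator (p y²; p)_∞.
-- Hence u = pz and v = p/z are the parameters, tied by uv = pr, and weights with a negative summand
-- in the exponent are defined by recursion. Infinite products are never formed either: they are
-- represented by Euler's coefficients and compared through recurrences x = y + p^(n+1) x, which
-- have one solution because 1 - p^(n+1) is invertible. Most identities keep all terms positive,
-- moving some to the other side, so that they are identities of commutative semirings.

tri : ℕ → ℕ
tri zero    = 0
tri (suc n) = n ℕ.+ tri n

module Antidiagonal {c ℓ} (R : CommutativeRing c ℓ) where
  open CommutativeRing R
  open import Relation.Binary.Reasoning.Setoid setoid
  open import Algebra.Solver.Ring.NaturalCoefficients.Default commutativeSemiring
    using (solve; _:=_; _:+_)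

  antid : ℕ → (ℕ → ℕ → Carrier) → Carrier
  antid zero    h = h 0 0
  antid (suc n) h = h 0 (suc n) + antid n (λ i j → h (suc i) j)

  antid-cong : ∀ n {f g} → (∀ i j → i ℕ.+ j ≡ n → f i j ≈ g i j) → antid n f ≈ antid n g
  antid-cong zero    eq = eq 0 0 ≡.refl
  antid-cong (suc n) eq =
    +-cong (eq 0 (suc n) ≡.refl) (antid-cong n (λ i j e → eq (suc i) j (≡.cong suc e)))

  antid-+ : ∀ n f g → antid n (λ i j → f i j + g i j) ≈ antid n f + antid n g
  antid-+ zero    f g = refl
  antid-+ (suc n) f g = begin
    (f 0 (suc n) + g 0 (suc n)) + antid n (λ i j → f (suc i) j + g (suc i) j)
      ≈⟨ +-congˡ (antid-+ n _ _) ⟩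
    (f 0 (suc n) + g 0 (suc n)) + (antid n (λ i j → f (suc i) j) + antid n (λ i j → g (suc i) j))
      ≈⟨ solve 4 (λ a b c d → (a :+ b) :+ (c :+ d) := (a :+ c) :+ (b :+ d)) refl _ _ _ _ ⟩
    antid (suc n) f + antid (suc n) g ∎

  antid-*ˡ : ∀ n x f → antid n (λ i j → x * f i j) ≈ x * antid n f
  antid-*ˡ zero    x f = refl
  antid-*ˡ (suc n) x f = trans (+-congˡ (antid-*ˡ n x _)) (sym (distribˡ x _ _))

  antid-0 : ∀ n → antid n (λ _ _ → 0#) ≈ 0#
  antid-0 zero    = refl
  antid-0 (suc n) = trans (+-identityˡ _) (antid-0 n)

  antid-last : ∀ n h → antid (suc n) h ≈ antid n (λ i j → h i (suc j)) + h (suc n) 0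
  antid-last zero    h = refl
  antid-last (suc n) h = trans (+-congˡ (antid-last n (λ i j → h (suc i) j))) (sym (+-assoc _ _ _))

  antid-comm : ∀ n h → antid n h ≈ antid n (λ i j → h j i)
  antid-comm zero    h = refl
  antid-comm (suc n) h = begin
    h 0 (suc n) + antid n (λ i j → h (suc i) j)  ≈⟨ +-congˡ (antid-comm n _) ⟩
    h 0 (suc n) + antid n (λ i j → h (suc j) i)  ≈⟨ +-comm _ _ ⟩
    antid n (λ i j → h (suc j) i) + h 0 (suc n)  ≈⟨ antid-last n (λ i j → h j i) ⟨
    antid (suc n) (λ i j → h j i)                ∎

  antid-assoc : ∀ n (h : ℕ → ℕ → ℕ → Carrier) →
    antid n (λ s k → antid s (λ i j → h i j k)) ≈ antid n (λ i s → antid s (λ j k → h i j k))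
  antid-assoc zero    h = refl
  antid-assoc (suc n) h = begin
    h 0 0 (suc n) + antid n (λ s k → h 0 (suc s) k + antid s (λ i j → h (suc i) j k))
      ≈⟨ +-congˡ (antid-+ n _ _) ⟩
    h 0 0 (suc n) + (antid n (λ s k → h 0 (suc s) k) + antid n (λ s k → antid s (λ i j → h (suc i) j k)))
      ≈⟨ +-assoc _ _ _ ⟨
    antid (suc n) (h 0) + antid n (λ s k → antid s (λ i j → h (suc i) j k))
      ≈⟨ +-congˡ (antid-assoc n (λ i → h (suc i))) ⟩
    antid (suc n) (h 0) + antid n (λ i s → antid s (λ j k → h (suc i) j k)) ∎

  antid-swap : ∀ m n (h : ℕ → ℕ → ℕ → ℕ → Carrier) →
    antid m (λ i j → antid n (λ k l → h i j k l)) ≈ antid n (λ k l → antid m (λ i j → h i j k l))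
  antid-swap zero    n h = refl
  antid-swap (suc m) n h = trans (+-congˡ (antid-swap m n (λ i → h (suc i)))) (sym (antid-+ n _ _))

  -- The substitution of y² for y, on coefficient sequences.
  spread : (ℕ → Carrier) → ℕ → Carrier
  spread f zero          = f 0
  spread f (suc zero)    = 0#
  spread f (suc (suc n)) = spread (λ i → f (suc i)) n

  spread-cong : ∀ {f g} → (∀ n → f n ≈ g n) → ∀ n → spread f n ≈ spread g n
  spread-cong eq zero          = eq 0
  spread-cong eq (suc zero)    = refl
  spread-cong eq (suc (suc n)) = spread-cong (λ i → eq (suc i)) n

  spread-+ : ∀ f g n → spread (λ i → f i + g i) n ≈ spread f n + spread g n
  spread-+ f g zero          = refl
  spread-+ f g (suc zero)    = sym (+-identityˡ 0#)
  spread-+ f g (suc (suc n)) = spread-+ (λ i → f (suc i)) (λ i → g (suc i)) n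

  spread-*ˡ : ∀ x f n → spread (λ i → x * f i) n ≈ x * spread f n
  spread-*ˡ x f zero          = refl
  spread-*ˡ x f (suc zero)    = sym (zeroʳ x)
  spread-*ˡ x f (suc (suc n)) = spread-*ˡ x (λ i → f (suc i)) n

module PowerSeries {c ℓ} (R : CommutativeRing c ℓ) where
  open CommutativeRing R
  open Antidiagonal R
  open import Relation.Binary.Reasoning.Setoid setoid

  Series : Set c
  Series = ℕ → Carrier

  one : Series
  one zero    = 1#
  one (suc _) = 0#

  infixl 7 _⊛_
  _⊛_ : Series → Series → Series
  (f ⊛ g) n = antid n (λ i j → f i * g j)

  one-⊛ : ∀ f n → (one ⊛ f) n ≈ f n
  one-⊛ f zero    = *-identityˡ _
  one-⊛ f (suc n) = begin
    1# * f (suc n) + antid n (λ i j → 0# * f j)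
      ≈⟨ +-cong (*-identityˡ _) (antid-cong n (λ _ _ _ → zeroˡ _)) ⟩
    f (suc n) + antid n (λ _ _ → 0#)  ≈⟨ +-congˡ (antid-0 n) ⟩
    f (suc n) + 0#                    ≈⟨ +-identityʳ _ ⟩
    f (suc n)                         ∎

  ⊛-comm : ∀ f g n → (f ⊛ g) n ≈ (g ⊛ f) n
  ⊛-comm f g n = trans (antid-comm n _) (antid-cong n (λ _ _ _ → *-comm _ _))

  ⊛-assoc : ∀ f g h n → ((f ⊛ g) ⊛ h) n ≈ (f ⊛ (g ⊛ h)) n
  ⊛-assoc f g h n = begin
    antid n (λ s k → antid s (λ i j → f i * g j) * h k)
      ≈⟨ antid-cong n (λ s k _ → trans (*-comm _ _) (sym (antid-*ˡ s (h k) _))) ⟩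
    antid n (λ s k → antid s (λ i j → h k * (f i * g j)))
      ≈⟨ antid-assoc n _ ⟩
    antid n (λ i s → antid s (λ j k → h k * (f i * g j)))
      ≈⟨ antid-cong n (λ i s _ → antid-cong s (λ j k _ → trans (*-comm _ _) (*-assoc _ _ _))) ⟩
    antid n (λ i s → antid s (λ j k → f i * (g j * h k)))
      ≈⟨ antid-cong n (λ i s _ → antid-*ˡ s (f i) _) ⟩
    antid n (λ i s → f i * antid s (λ j k → g j * h k)) ∎

  ⊛-distribˡ : ∀ f g h n → (f ⊛ (λ i → g i + h i)) n ≈ (f ⊛ g) n + (f ⊛ h) n
  ⊛-distribˡ f g h n = trans (antid-cong n (λ _ _ _ → distribˡ _ _ _)) (antid-+ n _ _)

  seriesRing : CommutativeRing c ℓ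
  seriesRing = record
    { Carrier = Series
    ; _≈_ = λ f g → ∀ n → f n ≈ g n
    ; _+_ = λ f g n → f n + g n
    ; _*_ = _⊛_
    ; -_  = λ f n → - f n
    ; 0#  = λ _ → 0#
    ; 1#  = one
    ; isCommutativeRing = record
      { isRing = record
        { +-isAbelianGroup = record
          { isGroup = record
            { isMonoid = record
              { isSemigroup = record
                { isMagma = record
                  { isEquivalence = record
                    { refl  = λ _ → refl
                    ; sym   = λ e n → sym (e n)
                    ; trans = λ e e′ n → trans (e n) (e′ n) }
                  ; ∙-cong = λ e e′ n → +-cong (e n) (e′ n) }
                ; assoc = λ _ _ _ _ → +-assoc _ _ _ }
              ; identity = (λ _ _ → +-identityˡ _) , (λ _ _ → +-identityʳ _) }
            ; inverse = (λ _ _ → -‿inverseˡ _) , (λ _ _ → -‿inverseʳ _)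
            ; ⁻¹-cong = λ e n → -‿cong (e n) }
          ; comm = λ _ _ _ → +-comm _ _ }
        ; *-cong = λ e e′ n → antid-cong n (λ i j _ → *-cong (e i) (e′ j))
        ; *-assoc = ⊛-assoc
        ; *-identity = one-⊛ , (λ f n → trans (⊛-comm f one n) (one-⊛ f n))
        ; distrib = ⊛-distribˡ , (λ f g h n →
            trans (⊛-comm _ f n) (trans (⊛-distribˡ f g h n) (+-cong (⊛-comm f g n) (⊛-comm f h n))))
        }
      ; *-comm = ⊛-comm
      }
    }

-- Base-p binomial sums

-- This makes `geom n` the inverse of 1 - p^(n+1), phrased as a fixed point to avoid subtraction.
GeometricInverses : ∀ {c ℓ} (R : CommutativeRing c ℓ) → let open CommutativeRing R in
  Carrier → (ℕ → Carrier) → Set ℓ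
GeometricInverses R p geom = ∀ n → geom n ≈ 1# + p ^ suc n * geom n
  where
  open CommutativeRing R
  open import Algebra.Properties.Semiring.Exp semiring using (_^_)

module Base {c ℓ} (R : CommutativeRing c ℓ) (p : CommutativeRing.Carrier R)
  (geom : ℕ → CommutativeRing.Carrier R) (geom-eq : GeometricInverses R p geom) where
  open CommutativeRing R
  open Antidiagonal R
  open import Relation.Binary.Reasoning.Setoid setoid
  open import Algebra.Properties.Semiring.Exp semiring using (_^_; ^-homo-*; ^-congʳ)
  open import Algebra.Solver.Ring.NaturalCoefficients.Default commutativeSemiring
    using (solve; _:=_; _:+_; _:*_; con)

  -- (p;p)_n and 1/(p;p)_n.
  P I : ℕ → Carrier
  P zero    = 1#
  P (suc n) = P n * (1# - p ^ suc n)
  I zero    = 1#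
  I (suc n) = I n * geom n

  sub-eq : ∀ {x y z} → x ≈ y + z → x - z ≈ y
  sub-eq {x} {y} {z} e = begin
    x - z        ≈⟨ +-congʳ e ⟩
    y + z - z    ≈⟨ +-assoc _ _ _ ⟩
    y + (z - z)  ≈⟨ +-congˡ (-‿inverseʳ z) ⟩
    y + 0#       ≈⟨ +-identityʳ _ ⟩
    y            ∎

  1-x* : ∀ x y → (1# - x) * y ≈ y - x * y
  1-x* x y = begin
    (1# - x) * y        ≈⟨ distribʳ y 1# (- x) ⟩
    1# * y + (- x) * y  ≈⟨ +-cong (*-identityˡ y) (sym (-‿distribˡ-* x y)) ⟩
    y - x * y           ∎
    where open import Algebra.Properties.Ring ring using (-‿distribˡ-*)

  1-x*-eq : ∀ {x y z} → y ≈ z + x * y → (1# - x) * y ≈ z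
  1-x*-eq e = trans (1-x* _ _) (sub-eq e)

  I-suc : ∀ n → I (suc n) ≈ I n + p ^ suc n * I (suc n)
  I-suc n = begin
    I n * geom n                        ≈⟨ *-congˡ (geom-eq n) ⟩
    I n * (1# + p ^ suc n * geom n)     ≈⟨ solve 3 (λ i t g → i :* (con 1 :+ t :* g) := i :+ t :* (i :* g)) refl _ _ _ ⟩
    I n + p ^ suc n * (I n * geom n)    ∎

  solution : ∀ n {x y} → x ≈ y + p ^ suc n * x → x ≈ geom n * y
  solution n {x} {y} e = begin
    x                                 ≈⟨ *-identityˡ x ⟨
    1# * x                            ≈⟨ *-congʳ (1-x*-eq (geom-eq n)) ⟨
    (1# - p ^ suc n) * geom n * x     ≈⟨ solve 3 (λ a g x → a :* g :* x := g :* (a :* x)) refl _ _ _ ⟩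
    geom n * ((1# - p ^ suc n) * x)   ≈⟨ *-congˡ (1-x*-eq e) ⟩
    geom n * y                        ∎

  -- Multiplication by `geom n` inverts 1 - p^(n+1). This is how closed forms are later identified:
  -- both are shown to satisfy the same recurrence.
  unique : ∀ n {x x′ y} → x ≈ y + p ^ suc n * x → x′ ≈ y + p ^ suc n * x′ → x ≈ x′
  unique n e e′ = trans (solution n e) (sym (solution n e′))

  I*P : ∀ n → I n * P n ≈ 1#
  I*P zero    = *-identityˡ 1#
  I*P (suc n) = begin
    I n * geom n * (P n * (1# - p ^ suc n))    ≈⟨ solve 4 (λ i g r s → i :* g :* (r :* s) := i :* r :* (s :* g)) refl _ _ _ _ ⟩
    I n * P n * ((1# - p ^ suc n) * geom n)    ≈⟨ *-cong (I*P n) (1-x*-eq (geom-eq n)) ⟩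
    1# * 1#                                    ≈⟨ *-identityˡ 1# ⟩
    1#                                         ∎

  -- Σᵢ φ(i) [n choose i]_p, by Pascal's rule.
  T : ℕ → (ℕ → Carrier) → Carrier
  T zero    φ = φ 0
  T (suc n) φ = T n (λ i → φ (suc i) + p ^ i * φ i)

  T-cong : ∀ n {φ ψ} → (∀ i → i ℕ.≤ n → φ i ≈ ψ i) → T n φ ≈ T n ψ
  T-cong zero    e = e 0 z≤n
  T-cong (suc n) e = T-cong n (λ i i≤n →
    +-cong (e (suc i) (s≤s i≤n)) (*-congˡ (e i (ℕₚ.m≤n⇒m≤1+n i≤n))))

  T-+ : ∀ n φ ψ → T n (λ i → φ i + ψ i) ≈ T n φ + T n ψ
  T-+ zero    φ ψ = refl
  T-+ (suc n) φ ψ = trans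
    (T-cong n (λ i _ → solve 5 (λ a b c d t → (a :+ b) :+ t :* (c :+ d) := (a :+ t :* c) :+ (b :+ t :* d))
       refl (φ (suc i)) (ψ (suc i)) (φ i) (ψ i) (p ^ i)))
    (T-+ n _ _)

  T-*ˡ : ∀ n x φ → T n (λ i → x * φ i) ≈ x * T n φ
  T-*ˡ zero    x φ = refl
  T-*ˡ (suc n) x φ = trans
    (T-cong n (λ i _ → solve 4 (λ x a b t → x :* a :+ t :* (x :* b) := x :* (a :+ t :* b))
       refl x (φ (suc i)) (φ i) (p ^ i)))
    (T-*ˡ n x _)

  -- The other Pascal rule, [n+1 choose i] = [n choose i] + p^(n+1-i) [n choose i-1]. The
  -- transformations of φ that express the two rules commute, which carries the induction.
  T-suc : ∀ n φ → T (suc n) φ ≈ T n (λ i → φ i + p ^ (n ∸ i) * φ (suc i))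
  T-suc zero φ = solve 2 (λ a b → b :+ con 1 :* a := a :+ con 1 :* b) refl (φ 0) (φ 1)
  T-suc (suc n) φ = trans (T-suc n (λ i → φ (suc i) + p ^ i * φ i)) (T-cong n step)
    where
    powers : ∀ i → i ℕ.≤ n → p ^ (n ∸ i) * p ^ suc i ≈ p ^ i * p ^ (suc n ∸ i)
    powers i i≤n = begin
      p ^ (n ∸ i) * p ^ suc i       ≈⟨ ^-homo-* p (n ∸ i) (suc i) ⟨
      p ^ (n ∸ i ℕ.+ suc i)         ≡⟨ ≡.cong (p ^_) (≡.trans (ℕₚ.+-suc _ i) (≡.cong suc (ℕₚ.m∸n+n≡m i≤n))) ⟩
      p ^ suc n                     ≡⟨ ≡.cong (p ^_) (ℕₚ.m+[n∸m]≡n (ℕₚ.m≤n⇒m≤1+n i≤n)) ⟨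
      p ^ (i ℕ.+ (suc n ∸ i))       ≈⟨ ^-homo-* p i (suc n ∸ i) ⟩
      p ^ i * p ^ (suc n ∸ i)       ∎
    step : ∀ i → i ℕ.≤ n →
      φ (suc i) + p ^ i * φ i + p ^ (n ∸ i) * (φ (suc (suc i)) + p ^ suc i * φ (suc i)) ≈
      φ (suc i) + p ^ (n ∸ i) * φ (suc (suc i)) + p ^ i * (φ i + p ^ (suc n ∸ i) * φ (suc i))
    step i i≤n = begin
      φ (suc i) + p ^ i * φ i + p ^ (n ∸ i) * (φ (suc (suc i)) + p ^ suc i * φ (suc i))
        ≈⟨ solve 6 (λ f₀ f₁ f₂ a b d → f₁ :+ a :* f₀ :+ b :* (f₂ :+ d :* f₁)
             := f₁ :+ b :* f₂ :+ a :* f₀ :+ b :* d :* f₁) refl (φ i) (φ (suc i)) (φ (suc (suc i))) (p ^ i) (p ^ (n ∸ i)) (p ^ suc i) ⟩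
      φ (suc i) + p ^ (n ∸ i) * φ (suc (suc i)) + p ^ i * φ i + p ^ (n ∸ i) * p ^ suc i * φ (suc i)
        ≈⟨ +-congˡ (*-congʳ (powers i i≤n)) ⟩
      φ (suc i) + p ^ (n ∸ i) * φ (suc (suc i)) + p ^ i * φ i + p ^ i * p ^ (suc n ∸ i) * φ (suc i)
        ≈⟨ solve 6 (λ f₀ f₁ f₂ a b d → f₁ :+ b :* f₂ :+ a :* f₀ :+ a :* d :* f₁
             := f₁ :+ b :* f₂ :+ a :* (f₀ :+ d :* f₁)) refl (φ i) (φ (suc i)) (φ (suc (suc i))) (p ^ i) (p ^ (n ∸ i)) (p ^ (suc n ∸ i)) ⟩
      φ (suc i) + p ^ (n ∸ i) * φ (suc (suc i)) + p ^ i * (φ i + p ^ (suc n ∸ i) * φ (suc i)) ∎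

  -- Here s counts what is left out of the first block and t what is taken from the second, so the
  -- power of p is p^(st). In the induction on a, one Pascal rule opens the left side and the other
  -- reassembles the right side.
  T-Vandermonde : ∀ a c φ → T (a ℕ.+ c) φ ≈ T a (λ s → T c (λ t → p ^ (s ℕ.* t) * φ (t ℕ.+ (a ∸ s))))
  T-Vandermonde zero c φ = T-cong c (λ t _ →
    sym (trans (*-identityˡ _) (reflexive (≡.cong φ (ℕₚ.+-identityʳ t)))))
  T-Vandermonde (suc a) c φ = begin
    T (a ℕ.+ c) (λ i → φ (suc i) + p ^ i * φ i)
      ≈⟨ T-Vandermonde a c _ ⟩
    T a (λ s → T c (λ t → p ^ (s ℕ.* t) * (φ (suc (t ℕ.+ (a ∸ s))) + p ^ (t ℕ.+ (a ∸ s)) * φ (t ℕ.+ (a ∸ s)))))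
      ≈⟨ T-cong a (λ s s≤a → T-cong c (λ t _ → step s t s≤a)) ⟩
    T a (λ s → T c (λ t → p ^ (s ℕ.* t) * φ (t ℕ.+ (suc a ∸ s)) + p ^ (a ∸ s) * (p ^ (suc s ℕ.* t) * φ (t ℕ.+ (a ∸ s)))))
      ≈⟨ T-cong a (λ s _ → trans (T-+ c _ _) (+-congˡ (T-*ˡ c _ _))) ⟩
    T a (λ s → T c (λ t → p ^ (s ℕ.* t) * φ (t ℕ.+ (suc a ∸ s))) + p ^ (a ∸ s) * T c (λ t → p ^ (suc s ℕ.* t) * φ (t ℕ.+ (a ∸ s))))
      ≈⟨ T-suc a _ ⟨
    T (suc a) (λ s → T c (λ t → p ^ (s ℕ.* t) * φ (t ℕ.+ (suc a ∸ s)))) ∎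
    where
    step : ∀ s t → s ℕ.≤ a →
      p ^ (s ℕ.* t) * (φ (suc (t ℕ.+ (a ∸ s))) + p ^ (t ℕ.+ (a ∸ s)) * φ (t ℕ.+ (a ∸ s))) ≈
      p ^ (s ℕ.* t) * φ (t ℕ.+ (suc a ∸ s)) + p ^ (a ∸ s) * (p ^ (suc s ℕ.* t) * φ (t ℕ.+ (a ∸ s)))
    step s t s≤a = begin
      p ^ (s ℕ.* t) * (φ (suc (t ℕ.+ (a ∸ s))) + p ^ (t ℕ.+ (a ∸ s)) * φ (t ℕ.+ (a ∸ s)))
        ≈⟨ *-congˡ (+-cong (reflexive (≡.cong φ shift)) (*-congʳ (^-homo-* p t (a ∸ s)))) ⟩
      p ^ (s ℕ.* t) * (φ (t ℕ.+ (suc a ∸ s)) + p ^ t * p ^ (a ∸ s) * φ (t ℕ.+ (a ∸ s)))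
        ≈⟨ solve 5 (λ x y z f g → x :* (f :+ y :* z :* g) := x :* f :+ z :* (y :* x :* g)) refl _ _ _ _ _ ⟩
      p ^ (s ℕ.* t) * φ (t ℕ.+ (suc a ∸ s)) + p ^ (a ∸ s) * (p ^ t * p ^ (s ℕ.* t) * φ (t ℕ.+ (a ∸ s)))
        ≈⟨ +-congˡ (*-congˡ (*-congʳ (^-homo-* p t (s ℕ.* t)))) ⟨
      p ^ (s ℕ.* t) * φ (t ℕ.+ (suc a ∸ s)) + p ^ (a ∸ s) * (p ^ (suc s ℕ.* t) * φ (t ℕ.+ (a ∸ s))) ∎
      where
      shift : suc (t ℕ.+ (a ∸ s)) ≡ t ℕ.+ (suc a ∸ s)
      shift = ≡.trans (≡.sym (ℕₚ.+-suc t (a ∸ s))) (≡.cong (t ℕ.+_) (≡.sym (ℕₚ.+-∸-assoc 1 s≤a)))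

  -- By 1 - p^(i+j) = (1 - p^i) + p^i (1 - p^j), multiplying the sum for n+1 by 1 - p^(n+1) lowers
  -- either i or j, which reproduces Pascal's rule. `first` treats i and `second` treats j.
  T-closed : ∀ n φ → T n φ ≈ P n * antid n (λ i j → I i * I j * φ i)
  T-closed zero φ = solve 1 (λ x → x := con 1 :* (con 1 :* con 1 :* x)) refl (φ 0)
  T-closed (suc n) φ = begin
    T n (λ i → φ (suc i) + p ^ i * φ i)
      ≈⟨ T-closed n _ ⟩
    P n * antid n (λ i j → I i * I j * (φ (suc i) + p ^ i * φ i))
      ≈⟨ *-congˡ (1-x*-eq recurrence) ⟨
    P n * ((1# - p ^ suc n) * A)
      ≈⟨ *-assoc _ _ _ ⟨
    P (suc n) * A ∎
    where
    A = antid (suc n) (λ i j → I i * I j * φ i)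
    first : A ≈ antid n (λ i j → I i * I j * φ (suc i)) + antid (suc n) (λ i j → p ^ i * (I i * I j * φ i))
    first = begin
      I 0 * I (suc n) * φ 0 + antid n (λ i j → I (suc i) * I j * φ (suc i))
        ≈⟨ +-congˡ (antid-cong n (λ i j _ → trans (*-congʳ (*-congʳ (I-suc i)))
             (solve 5 (λ x y z w t → (x :+ t :* y) :* z :* w := x :* z :* w :+ t :* (y :* z :* w)) refl _ _ _ _ _))) ⟩
      I 0 * I (suc n) * φ 0 + antid n (λ i j → I i * I j * φ (suc i) + p ^ suc i * (I (suc i) * I j * φ (suc i)))
        ≈⟨ +-congˡ (antid-+ n _ _) ⟩
      I 0 * I (suc n) * φ 0 + (antid n (λ i j → I i * I j * φ (suc i)) + antid n (λ i j → p ^ suc i * (I (suc i) * I j * φ (suc i))))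
        ≈⟨ solve 3 (λ a b c → a :+ (b :+ c) := b :+ (con 1 :* a :+ c)) refl _ _ _ ⟩
      antid n (λ i j → I i * I j * φ (suc i)) + antid (suc n) (λ i j → p ^ i * (I i * I j * φ i)) ∎
    second : antid (suc n) (λ i j → p ^ i * (I i * I j * φ i)) ≈ antid n (λ i j → I i * I j * (p ^ i * φ i)) + p ^ suc n * A
    second = begin
      antid (suc n) (λ i j → p ^ i * (I i * I j * φ i))
        ≈⟨ antid-last n (λ i j → p ^ i * (I i * I j * φ i)) ⟩
      antid n (λ i j → p ^ i * (I i * I (suc j) * φ i)) + p ^ suc n * (I (suc n) * I 0 * φ (suc n))
        ≈⟨ +-congʳ (antid-cong n (λ i j e → trans (*-congˡ (*-congʳ (*-congˡ (I-suc j)))) (trans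
             (solve 6 (λ x y z w t s → t :* (x :* (y :+ s :* z) :* w) := x :* y :* (t :* w) :+ t :* s :* (x :* z :* w)) refl _ _ _ _ _ _)
             (+-congˡ (*-congʳ (trans (sym (^-homo-* p i (suc j))) (^-congʳ p (≡.trans (ℕₚ.+-suc i j) (≡.cong suc e))))))))) ⟩
      antid n (λ i j → I i * I j * (p ^ i * φ i) + p ^ suc n * (I i * I (suc j) * φ i)) + p ^ suc n * (I (suc n) * I 0 * φ (suc n))
        ≈⟨ +-congʳ (trans (antid-+ n _ _) (+-congˡ (antid-*ˡ n _ _))) ⟩
      antid n (λ i j → I i * I j * (p ^ i * φ i)) + p ^ suc n * antid n (λ i j → I i * I (suc j) * φ i) + p ^ suc n * (I (suc n) * I 0 * φ (suc n))
        ≈⟨ solve 4 (λ a t b c → a :+ t :* b :+ t :* c := a :+ t :* (b :+ c)) refl _ _ _ _ ⟩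
      antid n (λ i j → I i * I j * (p ^ i * φ i)) + p ^ suc n * (antid n (λ i j → I i * I (suc j) * φ i) + I (suc n) * I 0 * φ (suc n))
        ≈⟨ +-congˡ (*-congˡ (antid-last n (λ i j → I i * I j * φ i))) ⟨
      antid n (λ i j → I i * I j * (p ^ i * φ i)) + p ^ suc n * A ∎
    recurrence : A ≈ antid n (λ i j → I i * I j * (φ (suc i) + p ^ i * φ i)) + p ^ suc n * A
    recurrence = begin
      A ≈⟨ trans first (+-congˡ second) ⟩
      antid n (λ i j → I i * I j * φ (suc i)) + (antid n (λ i j → I i * I j * (p ^ i * φ i)) + p ^ suc n * A)
        ≈⟨ +-assoc _ _ _ ⟨
      antid n (λ i j → I i * I j * φ (suc i)) + antid n (λ i j → I i * I j * (p ^ i * φ i)) + p ^ suc n * A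
        ≈⟨ +-congʳ (trans (antid-cong n (λ _ _ _ → distribˡ _ _ _)) (antid-+ n _ _)) ⟨
      antid n (λ i j → I i * I j * (φ (suc i) + p ^ i * φ i)) + p ^ suc n * A ∎

  I*T : ∀ n φ → I n * T n φ ≈ antid n (λ i j → I i * I j * φ i)
  I*T n φ = begin
    I n * T n φ                                       ≈⟨ *-congˡ (T-closed n φ) ⟩
    I n * (P n * antid n (λ i j → I i * I j * φ i))   ≈⟨ *-assoc _ _ _ ⟨
    I n * P n * antid n (λ i j → I i * I j * φ i)     ≈⟨ *-congʳ (I*P n) ⟩
    1# * antid n (λ i j → I i * I j * φ i)            ≈⟨ *-identityˡ _ ⟩
    antid n (λ i j → I i * I j * φ i)                 ∎

  -- A base-p count of pairs of subsets of sizes s = b + c and t = a + c in a set of size n: c is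
  -- the size of the intersection, a and b are the sizes of the two differences, and e is what lies
  -- outside both. The second Vandermonde sum cuts the inner n into s and its complement d.
  T²-closed : ∀ n (w : ℕ → ℕ → Carrier) → T n (λ s → T n (w s)) ≈
    P n * antid n (λ l e → I e * antid l (λ m c → I c * antid m (λ a b →
      I a * I b * (p ^ (a ℕ.* b) * w (b ℕ.+ c) (a ℕ.+ c)))))
  T²-closed n w = begin
    T n (λ s → T n (w s))
      ≈⟨ T-closed n _ ⟩
    P n * antid n (λ s d → I s * I d * T n (w s))
      ≈⟨ *-congˡ (antid-cong n split) ⟩
    P n * antid n (λ s d → antid s (λ b c → antid d (λ a e → F a b c e)))
      ≈⟨ *-congˡ rearrange ⟩
    P n * antid n (λ l e → antid l (λ m c → antid m (λ a b → F a b c e)))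
      ≈⟨ *-congˡ (antid-cong n factor) ⟩
    P n * antid n (λ l e → I e * antid l (λ m c → I c * antid m (λ a b → G a b c))) ∎
    where
    G : ℕ → ℕ → ℕ → Carrier
    G a b c = I a * I b * (p ^ (a ℕ.* b) * w (b ℕ.+ c) (a ℕ.+ c))
    F : ℕ → ℕ → ℕ → ℕ → Carrier
    F a b c e = I e * (I c * G a b c)
    exponents : ∀ s b c a → b ℕ.+ c ≡ s →
      p ^ (b ℕ.* a) * w s (a ℕ.+ (s ∸ b)) ≈ p ^ (a ℕ.* b) * w (b ℕ.+ c) (a ℕ.+ c)
    exponents s b c a ≡.refl = *-cong (^-congʳ p (ℕₚ.*-comm b a))
      (reflexive (≡.cong (λ k → w (b ℕ.+ c) (a ℕ.+ k)) (ℕₚ.m+n∸m≡n b c)))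
    split : ∀ s d → s ℕ.+ d ≡ n →
      I s * I d * T n (w s) ≈ antid s (λ b c → antid d (λ a e → F a b c e))
    split s d ≡.refl = begin
      I s * I d * T (s ℕ.+ d) (w s)
        ≈⟨ *-congˡ (T-Vandermonde s d (w s)) ⟩
      I s * I d * T s (λ b → T d (λ a → p ^ (b ℕ.* a) * w s (a ℕ.+ (s ∸ b))))
        ≈⟨ solve 3 (λ x y z → x :* y :* z := x :* (y :* z)) refl _ _ _ ⟩
      I s * (I d * T s (λ b → T d (λ a → p ^ (b ℕ.* a) * w s (a ℕ.+ (s ∸ b)))))
        ≈⟨ *-congˡ (trans (sym (T-*ˡ s (I d) _)) (T-cong s (λ b _ → I*T d _))) ⟩
      I s * T s (λ b → antid d (λ a e → I a * I e * (p ^ (b ℕ.* a) * w s (a ℕ.+ (s ∸ b)))))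
        ≈⟨ I*T s _ ⟩
      antid s (λ b c → I b * I c * antid d (λ a e → I a * I e * (p ^ (b ℕ.* a) * w s (a ℕ.+ (s ∸ b)))))
        ≈⟨ antid-cong s (λ b c b+c≡s → trans (sym (antid-*ˡ d _ _)) (antid-cong d (λ a e _ →
             trans (*-congˡ (*-congˡ (exponents s b c a b+c≡s)))
             (solve 5 (λ x y z t w → x :* y :* (z :* t :* w) := t :* (y :* (z :* x :* w))) refl _ _ _ _ _)))) ⟩
      antid s (λ b c → antid d (λ a e → F a b c e)) ∎
    rearrange : antid n (λ s d → antid s (λ b c → antid d (λ a e → F a b c e))) ≈
                antid n (λ l e → antid l (λ m c → antid m (λ a b → F a b c e)))
    rearrange = begin
      antid n (λ s d → antid s (λ b c → antid d (λ a e → F a b c e)))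
        ≈⟨ antid-cong n (λ s d _ → antid-swap s d (λ b c a e → F a b c e)) ⟩
      antid n (λ s d → antid d (λ a e → antid s (λ b c → F a b c e)))
        ≈⟨ antid-assoc n (λ s a e → antid s (λ b c → F a b c e)) ⟨
      antid n (λ l e → antid l (λ s a → antid s (λ b c → F a b c e)))
        ≈⟨ antid-cong n (λ l e _ → begin
             antid l (λ s a → antid s (λ b c → F a b c e))
               ≈⟨ antid-assoc l (λ b c a → F a b c e) ⟩
             antid l (λ b k → antid k (λ c a → F a b c e))
               ≈⟨ antid-cong l (λ b k _ → antid-comm k (λ c a → F a b c e)) ⟩
             antid l (λ b k → antid k (λ a c → F a b c e))
               ≈⟨ antid-assoc l (λ b a c → F a b c e) ⟨
             antid l (λ m c → antid m (λ b a → F a b c e))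
               ≈⟨ antid-cong l (λ m c _ → antid-comm m (λ b a → F a b c e)) ⟩
             antid l (λ m c → antid m (λ a b → F a b c e)) ∎) ⟩
      antid n (λ l e → antid l (λ m c → antid m (λ a b → F a b c e))) ∎
    factor : ∀ l e → l ℕ.+ e ≡ n → antid l (λ m c → antid m (λ a b → F a b c e)) ≈
      I e * antid l (λ m c → I c * antid m (λ a b → G a b c))
    factor l e _ = begin
      antid l (λ m c → antid m (λ a b → F a b c e))
        ≈⟨ antid-cong l (λ m c _ → trans (antid-*ˡ m _ _) (*-congˡ (antid-*ˡ m _ _))) ⟩
      antid l (λ m c → I e * (I c * antid m (λ a b → G a b c)))
        ≈⟨ antid-*ˡ l _ _ ⟩
      I e * antid l (λ m c → I c * antid m (λ a b → G a b c)) ∎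

  -- Euler's products in y and the weight with exponent -ab

  open PowerSeries R using (_⊛_)

  -- The coefficients of (-u y; p)_∞ in y.
  E : Carrier → ℕ → Carrier
  E u n = p ^ tri n * (u ^ n * I n)

  -- The coefficients of 1/(r y; p)_∞ in y.
  κ : Carrier → ℕ → Carrier
  κ r n = r ^ n * I n

  -- The coefficients of E_u(y) = (1 + u y) E_u(p y).
  E-suc : ∀ u n → E u (suc n) ≈ p ^ n * u * E u n + p ^ suc n * E u (suc n)
  E-suc u n = begin
    p ^ (n ℕ.+ tri n) * (u * u ^ n * I (suc n))
      ≈⟨ *-congˡ (*-congˡ (I-suc n)) ⟩
    p ^ (n ℕ.+ tri n) * (u * u ^ n * (I n + p ^ suc n * I (suc n)))
      ≈⟨ solve 5 (λ a u v x y → a :* (u :* v :* (x :+ y)) := a :* (u :* (v :* x)) :+ a :* (u :* v :* y)) refl _ _ _ _ _ ⟩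
    p ^ (n ℕ.+ tri n) * (u * (u ^ n * I n)) + p ^ (n ℕ.+ tri n) * (u * u ^ n * (p ^ suc n * I (suc n)))
      ≈⟨ +-cong
           (trans (*-congʳ (^-homo-* p n (tri n))) (solve 4 (λ a b u x → a :* b :* (u :* x) := a :* u :* (b :* x)) refl _ _ _ _))
           (solve 4 (λ a v t x → a :* (v :* (t :* x)) := t :* (a :* (v :* x))) refl _ _ _ _) ⟩
    p ^ n * u * E u n + p ^ suc n * E u (suc n) ∎

  module _ (u v r : Carrier) (uv≈pr : u * v ≈ p * r) where

    -- p^(tri a + tri b - a b) u^a v^b, without the negative exponent.
    K : ℕ → ℕ → Carrier
    K zero    b       = p ^ tri b * v ^ b
    K (suc a) zero    = p ^ tri (suc a) * u ^ suc a
    K (suc a) (suc b) = r * K a b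

    K-zeroʳ : ∀ a → K a 0 ≈ p ^ tri a * u ^ a
    K-zeroʳ zero    = refl
    K-zeroʳ (suc a) = refl

    -- Raising b multiplies the weight by p^(b-a) v; p^a stays on the left since p need not be
    -- invertible. The relation uv = pr enters where the diagonal recursion meets the edge b = 0.
    K-sucʳ : ∀ a b → p ^ a * K a (suc b) ≈ p ^ b * v * K a b
    K-sucʳ zero b = begin
      1# * (p ^ (b ℕ.+ tri b) * (v * v ^ b))   ≈⟨ *-congˡ (*-congʳ (^-homo-* p b (tri b))) ⟩
      1# * (p ^ b * p ^ tri b * (v * v ^ b))   ≈⟨ solve 4 (λ a b v w → con 1 :* (a :* b :* (v :* w)) := a :* v :* (b :* w)) refl _ _ _ _ ⟩
      p ^ b * v * (p ^ tri b * v ^ b)          ∎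
    K-sucʳ (suc a) zero = begin
      p * p ^ a * (r * K a 0)                     ≈⟨ *-congˡ (*-congˡ (K-zeroʳ a)) ⟩
      p * p ^ a * (r * (p ^ tri a * u ^ a))       ≈⟨ solve 5 (λ p a r b w → p :* a :* (r :* (b :* w)) := p :* r :* (a :* b :* w)) refl _ _ _ _ _ ⟩
      p * r * (p ^ a * p ^ tri a * u ^ a)         ≈⟨ *-cong uv≈pr (*-congʳ (^-homo-* p a (tri a))) ⟨
      u * v * (p ^ (a ℕ.+ tri a) * u ^ a)         ≈⟨ solve 4 (λ u v x w → u :* v :* (x :* w) := con 1 :* v :* (x :* (u :* w))) refl _ _ _ _ ⟩
      1# * v * (p ^ (a ℕ.+ tri a) * (u * u ^ a))  ∎
    K-sucʳ (suc a) (suc b) = begin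
      p * p ^ a * (r * K a (suc b))    ≈⟨ solve 4 (λ p a r k → p :* a :* (r :* k) := p :* r :* (a :* k)) refl _ _ _ _ ⟩
      p * r * (p ^ a * K a (suc b))    ≈⟨ *-congˡ (K-sucʳ a b) ⟩
      p * r * (p ^ b * v * K a b)      ≈⟨ solve 5 (λ p r b v k → p :* r :* (b :* v :* k) := p :* b :* v :* (r :* k)) refl _ _ _ _ _ ⟩
      p * p ^ b * v * (r * K a b)      ∎

    -- Σₙ ρ(n) E_u(a-n) E_v(b-n), the coefficient of x^a y^b in ρ(x y) E_u(x) E_v(y).
    S : (ℕ → Carrier) → ℕ → ℕ → Carrier
    S ρ zero    b       = ρ 0 * (E u 0 * E v b)
    S ρ (suc a) zero    = ρ 0 * (E u (suc a) * E v 0)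
    S ρ (suc a) (suc b) = ρ 0 * (E u (suc a) * E v (suc b)) + S (λ n → ρ (suc n)) a b

    S-zeroʳ : ∀ ρ a → S ρ a 0 ≈ ρ 0 * (E u a * E v 0)
    S-zeroʳ ρ zero    = refl
    S-zeroʳ ρ (suc a) = refl

    S-cong : ∀ {ρ σ} a b → (∀ n → ρ n ≈ σ n) → S ρ a b ≈ S σ a b
    S-cong zero    b       e = *-congʳ (e 0)
    S-cong (suc a) zero    e = *-congʳ (e 0)
    S-cong (suc a) (suc b) e = +-cong (*-congʳ (e 0)) (S-cong a b (λ n → e (suc n)))

    S-+ : ∀ ρ σ a b → S (λ n → ρ n + σ n) a b ≈ S ρ a b + S σ a b
    S-+ ρ σ zero    b       = distribʳ _ _ _
    S-+ ρ σ (suc a) zero    = distribʳ _ _ _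
    S-+ ρ σ (suc a) (suc b) = trans (+-cong (distribʳ _ _ _) (S-+ _ _ a b))
      (solve 4 (λ a b c d → (a :+ b) :+ (c :+ d) := (a :+ c) :+ (b :+ d)) refl _ _ _ _)

    S-*ˡ : ∀ x ρ a b → S (λ n → x * ρ n) a b ≈ x * S ρ a b
    S-*ˡ x ρ zero    b       = *-assoc _ _ _
    S-*ˡ x ρ (suc a) zero    = *-assoc _ _ _
    S-*ˡ x ρ (suc a) (suc b) = trans (+-cong (*-assoc _ _ _) (S-*ˡ x _ a b)) (sym (distribˡ _ _ _))

    -- By E_u(x) = (1 + u x) E_u(p x), the series ρ(p x y) E_u(x) E_v(y) is 1 + u x times the
    -- dilation x -> p x of ρ(x y) E_u(x) E_v(y).
    S-scaled : ∀ ρ a b → S (λ n → p ^ n * ρ n) (suc a) b ≈ p ^ a * u * S ρ a b + p ^ suc a * S ρ (suc a) b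
    S-scaled ρ a zero = begin
      1# * ρ 0 * (E u (suc a) * E v 0)
        ≈⟨ *-cong (*-identityˡ _) (*-congʳ (E-suc u a)) ⟩
      ρ 0 * ((p ^ a * u * E u a + p ^ suc a * E u (suc a)) * E v 0)
        ≈⟨ solve 6 (λ x a b c d e → x :* ((a :* b :+ c :* d) :* e) := a :* (x :* (b :* e)) :+ c :* (x :* (d :* e))) refl (ρ 0) _ _ _ _ _ ⟩
      p ^ a * u * (ρ 0 * (E u a * E v 0)) + p ^ suc a * (ρ 0 * (E u (suc a) * E v 0))
        ≈⟨ +-congʳ (*-congˡ (S-zeroʳ ρ a)) ⟨
      p ^ a * u * S ρ a 0 + p ^ suc a * S ρ (suc a) 0 ∎
    S-scaled ρ zero (suc b) = begin
      1# * ρ 0 * (E u 1 * E v (suc b)) + p * 1# * ρ 1 * (E u 0 * E v b)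
        ≈⟨ +-congʳ (*-congˡ (*-congʳ (E-suc u 0))) ⟩
      1# * ρ 0 * ((1# * u * E u 0 + p ^ 1 * E u 1) * E v (suc b)) + p * 1# * ρ 1 * (E u 0 * E v b)
        ≈⟨ solve 8 (λ r₀ r₁ u e₀ e₁ v₀ v₁ p →
             con 1 :* r₀ :* ((con 1 :* u :* e₀ :+ p :* con 1 :* e₁) :* v₁) :+ p :* con 1 :* r₁ :* (e₀ :* v₀)
             := con 1 :* u :* (r₀ :* (e₀ :* v₁)) :+ p :* con 1 :* (r₀ :* (e₁ :* v₁) :+ r₁ :* (e₀ :* v₀)))
             refl (ρ 0) (ρ 1) u (E u 0) (E u 1) (E v b) (E v (suc b)) p ⟩
      1# * u * (ρ 0 * (E u 0 * E v (suc b))) + p ^ 1 * (ρ 0 * (E u 1 * E v (suc b)) + ρ 1 * (E u 0 * E v b)) ∎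
    S-scaled ρ (suc a) (suc b) = begin
      1# * ρ 0 * (E u (suc (suc a)) * E v (suc b)) + S (λ n → p * p ^ n * ρ (suc n)) (suc a) b
        ≈⟨ +-cong (*-congˡ (*-congʳ (E-suc u (suc a))))
             (trans (S-cong (suc a) b (λ n → *-assoc _ _ _)) (trans (S-*ˡ p _ (suc a) b) (*-congˡ (S-scaled _ a b)))) ⟩
      1# * ρ 0 * ((p ^ suc a * u * E u (suc a) + p ^ suc (suc a) * E u (suc (suc a))) * E v (suc b))
        + p * (p ^ a * u * S (λ n → ρ (suc n)) a b + p ^ suc a * S (λ n → ρ (suc n)) (suc a) b)
        ≈⟨ solve 9 (λ r p x u e₁ e₂ v s s′ →
             con 1 :* r :* ((p :* x :* u :* e₁ :+ p :* (p :* x) :* e₂) :* v) :+ p :* (x :* u :* s :+ p :* x :* s′)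
             := p :* x :* u :* (r :* (e₁ :* v) :+ s) :+ p :* (p :* x) :* (r :* (e₂ :* v) :+ s′))
             refl (ρ 0) p (p ^ a) u (E u (suc a)) (E u (suc (suc a))) (E v (suc b)) _ _ ⟩
      p ^ suc a * u * S ρ (suc a) (suc b) + p ^ suc (suc a) * S ρ (suc (suc a)) (suc b) ∎

    -- The coefficients of G(x, y) = (1 + u x) G(p x, y) + r x y G(x, y) for G(x, y) = E_u(x) E_v(y)
    -- / (r x y; p)_∞.
    S-suc : ∀ a b → S (κ r) (suc a) (suc b) ≈
      (p ^ a * u * S (κ r) a (suc b) + r * S (κ r) a b) + p ^ suc a * S (κ r) (suc a) (suc b)
    S-suc a b = begin
      κ r 0 * (E u (suc a) * E v (suc b)) + S (λ n → κ r (suc n)) a b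
        ≈⟨ +-cong (*-congʳ (sym (*-identityˡ _))) (trans (S-cong a b κ-suc) (trans (S-+ _ _ a b) (+-congʳ (S-*ˡ r _ a b)))) ⟩
      1# * κ r 0 * (E u (suc a) * E v (suc b)) + (r * S (κ r) a b + S (λ n → p ^ suc n * κ r (suc n)) a b)
        ≈⟨ solve 3 (λ a b c → a :+ (b :+ c) := (a :+ c) :+ b) refl _ _ _ ⟩
      S (λ n → p ^ n * κ r n) (suc a) (suc b) + r * S (κ r) a b
        ≈⟨ +-congʳ (S-scaled (κ r) a (suc b)) ⟩
      p ^ a * u * S (κ r) a (suc b) + p ^ suc a * S (κ r) (suc a) (suc b) + r * S (κ r) a b
        ≈⟨ solve 3 (λ a b c → a :+ b :+ c := a :+ c :+ b) refl _ _ _ ⟩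
      (p ^ a * u * S (κ r) a (suc b) + r * S (κ r) a b) + p ^ suc a * S (κ r) (suc a) (suc b) ∎
      where
      κ-suc : ∀ n → κ r (suc n) ≈ r * κ r n + p ^ suc n * κ r (suc n)
      κ-suc n = begin
        r * r ^ n * I (suc n)                               ≈⟨ *-congˡ (I-suc n) ⟩
        r * r ^ n * (I n + p ^ suc n * I (suc n))           ≈⟨ solve 5 (λ r s i t j → r :* s :* (i :+ t :* j) := r :* (s :* i) :+ t :* (r :* s :* j)) refl _ _ _ _ _ ⟩
        r * (r ^ n * I n) + p ^ suc n * (r * r ^ n * I (suc n)) ∎

    -- This resolves p^(-ab) / ((p;p)_a (p;p)_b) into a sum over overlaps. The left side satisfies
    -- the recurrence of `S-suc` as well, and that recurrence only refers back to smaller a, so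
    -- induction on a and `unique` suffice.
    KII≈S : ∀ a b → I a * I b * K a b ≈ S (κ r) a b
    KII≈S zero b =
      solve 3 (λ i t w → con 1 :* i :* (t :* w) := con 1 :* con 1 :* (con 1 :* (con 1 :* con 1) :* (t :* (w :* i)))) refl _ _ _
    KII≈S (suc a) zero =
      solve 3 (λ i t w → i :* con 1 :* (t :* w) := con 1 :* con 1 :* (t :* (w :* i) :* (con 1 :* (con 1 :* con 1)))) refl _ _ _
    KII≈S (suc a) (suc b) = unique a recurrence (S-suc a b)
      where
      A = p ^ suc a * (I (suc a) * I (suc b) * K (suc a) (suc b))
      recurrence : I (suc a) * I (suc b) * K (suc a) (suc b) ≈
        (p ^ a * u * S (κ r) a (suc b) + r * S (κ r) a b) + A
      recurrence = begin
        I (suc a) * I (suc b) * (r * K a b)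
          ≈⟨ *-congʳ (*-congʳ (I-suc a)) ⟩
        (I a + p ^ suc a * I (suc a)) * I (suc b) * (r * K a b)
          ≈⟨ solve 6 (λ i t j k r s → (i :+ t :* j) :* k :* (r :* s) := r :* (i :* k :* s) :+ t :* (j :* k :* (r :* s))) refl _ _ _ _ _ _ ⟩
        r * (I a * I (suc b) * K a b) + A
          ≈⟨ +-congʳ (*-congˡ (*-congʳ (*-congˡ (I-suc b)))) ⟩
        r * (I a * (I b + p ^ suc b * I (suc b)) * K a b) + A
          ≈⟨ +-congʳ (solve 7 (λ i j r k b p j′ → r :* (i :* (j :+ p :* b :* j′) :* k) := p :* r :* (i :* j′ :* b :* k) :+ r :* (i :* j :* k)) refl _ _ _ _ _ _ _) ⟩
        p * r * (I a * I (suc b) * p ^ b * K a b) + r * (I a * I b * K a b) + A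
          -- Once p r is traded for u v, `K-sucʳ` turns p^b v K(a, b) into p^a K(a, b+1), the one
          -- term of the recurrence in which b is raised.
          ≈⟨ +-congʳ (+-congʳ (*-congʳ uv≈pr)) ⟨
        u * v * (I a * I (suc b) * p ^ b * K a b) + r * (I a * I b * K a b) + A
          ≈⟨ +-congʳ (+-congʳ (trans (solve 5 (λ u v i p k → u :* v :* (i :* p :* k) := u :* i :* (p :* v :* k)) refl _ _ _ _ _) (*-congˡ (sym (K-sucʳ a b))))) ⟩
        u * (I a * I (suc b)) * (p ^ a * K a (suc b)) + r * (I a * I b * K a b) + A
          ≈⟨ +-congʳ (+-cong (trans (solve 4 (λ u i p k → u :* i :* (p :* k) := p :* u :* (i :* k)) refl _ _ _ _) (*-congˡ (KII≈S a (suc b)))) (*-congˡ (KII≈S a b))) ⟩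
        (p ^ a * u * S (κ r) a (suc b) + r * S (κ r) a b) + A ∎

    -- This is the specialisation x = y: a unit of overlap uses one x and one y, so it counts for
    -- two degrees, whence `spread`. Accordingly the induction descends by two.
    antid-S : ∀ m ρ → antid m (S ρ) ≈ (spread ρ ⊛ (E u ⊛ E v)) m
    antid-S zero ρ = refl
    antid-S (suc zero) ρ = solve 4 (λ r x y z → r :* x :+ r :* y := r :* (x :+ y) :+ con 0 :* z) refl (ρ 0) (E u 0 * E v 1) (E u 1 * E v 0) (E u 0 * E v 0)
    antid-S (suc (suc m)) ρ = begin
      ρ 0 * h 0 (suc (suc m)) + antid (suc m) (λ i j → S ρ (suc i) j)
        ≈⟨ +-congˡ (antid-last m (λ i j → S ρ (suc i) j)) ⟩
      ρ 0 * h 0 (suc (suc m)) + (antid m (λ i j → ρ 0 * h (suc i) (suc j) + S ρ′ i j) + ρ 0 * h (suc (suc m)) 0)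
        ≈⟨ +-congˡ (+-congʳ (trans (antid-+ m _ _) (+-cong (antid-*ˡ m _ _) (antid-S m ρ′)))) ⟩
      ρ 0 * h 0 (suc (suc m)) + (ρ 0 * antid m (λ i j → h (suc i) (suc j)) + (spread ρ′ ⊛ (E u ⊛ E v)) m + ρ 0 * h (suc (suc m)) 0)
        ≈⟨ solve 6 (λ r x y z w t → r :* x :+ (r :* y :+ z :+ r :* w) := r :* (x :+ (y :+ w)) :+ (con 0 :* t :+ z)) refl _ _ _ _ _ ((E u ⊛ E v) (suc m)) ⟩
      ρ 0 * (h 0 (suc (suc m)) + (antid m (λ i j → h (suc i) (suc j)) + h (suc (suc m)) 0))
        + (0# * (E u ⊛ E v) (suc m) + (spread ρ′ ⊛ (E u ⊛ E v)) m)
        ≈⟨ +-congʳ (*-congˡ (+-congˡ (antid-last m (λ i j → h (suc i) j)))) ⟨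
      ρ 0 * (E u ⊛ E v) (suc (suc m)) + (0# * (E u ⊛ E v) (suc m) + (spread ρ′ ⊛ (E u ⊛ E v)) m) ∎
      where
      h : ℕ → ℕ → Carrier
      h i j = E u i * E v j
      ρ′ : ℕ → Carrier
      ρ′ n = ρ (suc n)

    antid-K : ∀ m → antid m (λ a b → I a * I b * K a b) ≈ (spread (κ r) ⊛ (E u ⊛ E v)) m
    antid-K m = trans (antid-cong m (λ a b _ → KII≈S a b)) (antid-S m (κ r))

    -- The binomial index a + c + (n - (b + c)) is n + (a - b), so j = a - b; the bound b + c ≤ n
    -- keeps the subtraction exact. The hypothesis asks that the weight factor into p^(tri(a+b+c)),
    -- a part in c that yields E_p, and the part K in a and b.
    T-double : ∀ n φ →
      (∀ a b c → b ℕ.+ c ℕ.≤ n →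
        p ^ (a ℕ.* b) * (p ^ ((b ℕ.+ c) ℕ.* (a ℕ.+ c)) * φ (a ℕ.+ c ℕ.+ (n ∸ (b ℕ.+ c)))) ≈
        p ^ tri (a ℕ.+ b ℕ.+ c) * (p ^ tri c * p ^ c * K a b)) →
      T (n ℕ.+ n) φ ≈ P n * antid n (λ l e → I e * (p ^ tri l * ((spread (κ r) ⊛ (E u ⊛ E v)) ⊛ E p) l))
    T-double n φ weight = begin
      T (n ℕ.+ n) φ
        ≈⟨ T-Vandermonde n n φ ⟩
      T n (λ s → T n (λ t → p ^ (s ℕ.* t) * φ (t ℕ.+ (n ∸ s))))
        ≈⟨ T²-closed n (λ s t → p ^ (s ℕ.* t) * φ (t ℕ.+ (n ∸ s))) ⟩
      P n * antid n (λ l e → I e * antid l (λ m c → I c * antid m (λ a b →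
        I a * I b * (p ^ (a ℕ.* b) * (p ^ ((b ℕ.+ c) ℕ.* (a ℕ.+ c)) * φ (a ℕ.+ c ℕ.+ (n ∸ (b ℕ.+ c))))))))
        ≈⟨ *-congˡ (antid-cong n (λ l e l+e≡n → *-congˡ (inner l (ℕₚ.m+n≤o⇒m≤o l (ℕₚ.≤-reflexive l+e≡n))))) ⟩
      P n * antid n (λ l e → I e * (p ^ tri l * ((spread (κ r) ⊛ (E u ⊛ E v)) ⊛ E p) l)) ∎
      where
      coefficient : ∀ l m c → m ℕ.+ c ≡ l → l ℕ.≤ n → ∀ a b → a ℕ.+ b ≡ m →
        I a * I b * (p ^ (a ℕ.* b) * (p ^ ((b ℕ.+ c) ℕ.* (a ℕ.+ c)) * φ (a ℕ.+ c ℕ.+ (n ∸ (b ℕ.+ c))))) ≈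
        p ^ tri l * (p ^ tri c * p ^ c) * (I a * I b * K a b)
      coefficient _ _ c ≡.refl l≤n a b ≡.refl = trans
        (*-congˡ (weight a b c (ℕₚ.≤-trans (ℕₚ.+-monoˡ-≤ c (ℕₚ.m≤n+m b a)) l≤n)))
        (solve 4 (λ i t s k → i :* (t :* (s :* k)) := t :* s :* (i :* k)) refl _ _ _ _)
      inner : ∀ l → l ℕ.≤ n →
        antid l (λ m c → I c * antid m (λ a b →
          I a * I b * (p ^ (a ℕ.* b) * (p ^ ((b ℕ.+ c) ℕ.* (a ℕ.+ c)) * φ (a ℕ.+ c ℕ.+ (n ∸ (b ℕ.+ c))))))) ≈
        p ^ tri l * ((spread (κ r) ⊛ (E u ⊛ E v)) ⊛ E p) l
      inner l l≤n = trans
        (antid-cong l (λ m c m+c≡l → trans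
          (*-congˡ (trans (antid-cong m (coefficient l m c m+c≡l l≤n)) (trans (antid-*ˡ m _ _) (*-congˡ (antid-K m)))))
          (solve 5 (λ i x y z w → i :* (x :* (y :* z) :* w) := x :* (w :* (y :* (z :* i)))) refl _ _ _ _ _)))
        (antid-*ˡ l _ _)

-- Monomials, dilations and truncated sums

module Monomials {c ℓ} (R : CommutativeRing c ℓ) where
  open CommutativeRing R
  open Antidiagonal R
  open PowerSeries R
  open import Algebra.Properties.Semiring.Exp semiring using (_^_; ^-homo-*)
  open import Relation.Binary.Reasoning.Setoid setoid
  open import Algebra.Solver.Ring.NaturalCoefficients.Default commutativeSemiring
    using (solve; _:=_; _:+_; _:*_; con)

  Y : Series
  Y zero    = 0#
  Y (suc n) = one n

  C : Carrier → Series
  C u zero    = u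
  C u (suc _) = 0#

  C-⊛ : ∀ u f n → (C u ⊛ f) n ≈ u * f n
  C-⊛ u f zero    = refl
  C-⊛ u f (suc n) = trans
    (+-congˡ (trans (antid-cong n (λ _ _ _ → zeroˡ _)) (antid-0 n))) (+-identityʳ _)

  Y-⊛-suc : ∀ f n → (Y ⊛ f) (suc n) ≈ f n
  Y-⊛-suc f n = trans (+-cong (zeroˡ _) (one-⊛ f n)) (+-identityˡ _)

  -- The dilation f(y) -> f(s y).
  scale : Carrier → Series → Series
  scale s f n = s ^ n * f n

  scale-⊛ : ∀ s f g n → scale s (f ⊛ g) n ≈ (scale s f ⊛ scale s g) n
  scale-⊛ s f g n = trans (sym (antid-*ˡ n _ _)) (antid-cong n step)
    where
    step : ∀ i j → i ℕ.+ j ≡ n → s ^ n * (f i * g j) ≈ s ^ i * f i * (s ^ j * g j)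
    step i j ≡.refl = trans (*-congʳ (^-homo-* s i j))
      (solve 4 (λ a b x y → a :* b :* (x :* y) := a :* x :* (b :* y)) refl _ _ _ _)

  scale-spread : ∀ s f n → scale s (spread f) n ≈ spread (λ i → (s * s) ^ i * f i) n
  scale-spread s f zero          = refl
  scale-spread s f (suc zero)    = zeroʳ _
  scale-spread s f (suc (suc n)) = begin
    s * (s * s ^ n) * spread f′ n                  ≈⟨ solve 3 (λ s t x → s :* (s :* t) :* x := s :* s :* (t :* x)) refl _ _ _ ⟩
    s * s * (s ^ n * spread f′ n)                  ≈⟨ *-congˡ (scale-spread s f′ n) ⟩
    s * s * spread (λ i → (s * s) ^ i * f′ i) n    ≈⟨ spread-*ˡ (s * s) _ n ⟨
    spread (λ i → s * s * ((s * s) ^ i * f′ i)) n  ≈⟨ spread-cong (λ i → sym (*-assoc _ _ _)) n ⟩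
    spread (λ i → (s * s) ^ suc i * f′ i) n        ∎
    where
    f′ : ℕ → Carrier
    f′ i = f (suc i)

  -- The hypotheses say f(y) = g(y) + r y f(y); here y² is substituted for y.
  spread-recurrence : ∀ r f g → f 0 ≈ g 0 → (∀ n → f (suc n) ≈ g (suc n) + r * f n) →
    ∀ n → spread f n ≈ spread g n + (C r ⊛ (Y ⊛ (Y ⊛ spread f))) n
  spread-recurrence r f g e₀ e zero = trans e₀
    (solve 3 (λ g r f → g := g :+ r :* (con 0 :* (con 0 :* f))) refl (g 0) r (f 0))
  spread-recurrence r f g e₀ e (suc zero) = sym (begin
    0# + (C r ⊛ (Y ⊛ (Y ⊛ spread f))) 1  ≈⟨ +-identityˡ _ ⟩
    (C r ⊛ (Y ⊛ (Y ⊛ spread f))) 1       ≈⟨ C-⊛ r (Y ⊛ (Y ⊛ spread f)) 1 ⟩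
    r * (Y ⊛ (Y ⊛ spread f)) 1           ≈⟨ *-congˡ (Y-⊛-suc (Y ⊛ spread f) 0) ⟩
    r * (0# * f 0)                       ≈⟨ trans (*-congˡ (zeroˡ _)) (zeroʳ r) ⟩
    0#                                   ∎)
  spread-recurrence r f g e₀ e (suc (suc n)) = begin
    spread (λ i → f (suc i)) n                                ≈⟨ spread-cong e n ⟩
    spread (λ i → g (suc i) + r * f i) n                      ≈⟨ spread-+ _ _ n ⟩
    spread g (suc (suc n)) + spread (λ i → r * f i) n         ≈⟨ +-congˡ (spread-*ˡ r f n) ⟩
    spread g (suc (suc n)) + r * spread f n
      ≈⟨ +-congˡ (*-congˡ (trans (Y-⊛-suc (Y ⊛ spread f) (suc n)) (Y-⊛-suc (spread f) n))) ⟨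
    spread g (suc (suc n)) + r * (Y ⊛ (Y ⊛ spread f)) (suc (suc n))
      ≈⟨ +-congˡ (C-⊛ r (Y ⊛ (Y ⊛ spread f)) (suc (suc n))) ⟨
    spread g (suc (suc n)) + (C r ⊛ (Y ⊛ (Y ⊛ spread f))) (suc (suc n)) ∎

  spread-*ʳ : ∀ f (g : ℕ → Carrier) n → spread f n * g n ≈ spread (λ i → f i * g (i ℕ.+ i)) n
  spread-*ʳ f g zero          = refl
  spread-*ʳ f g (suc zero)    = zeroˡ _
  spread-*ʳ f g (suc (suc n)) = trans (spread-*ʳ (λ i → f (suc i)) (λ i → g (suc (suc i))) n)
    (spread-cong (λ i → *-congˡ (reflexive (≡.cong (λ k → g (suc k)) (≡.sym (ℕₚ.+-suc i i))))) n)

  sumTo : ℕ → (ℕ → Carrier) → Carrier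
  sumTo n f = antid n (λ i _ → f i)

  sumTo-0 : ∀ n f → (∀ i → f i ≈ 0#) → sumTo n f ≈ 0#
  sumTo-0 n f e = trans (antid-cong n (λ i _ _ → e i)) (antid-0 n)

  sumTo-antid : ∀ k n f (g : ℕ → ℕ → Carrier) → k ℕ.≤ n →
    (∀ i j → i ℕ.+ j ≡ k → f i ≈ g i j) → (∀ i → k ℕ.< i → f i ≈ 0#) → sumTo n f ≈ antid k g
  sumTo-antid zero    zero    f g z≤n      e e₀ = e 0 0 ≡.refl
  sumTo-antid zero    (suc n) f g z≤n      e e₀ =
    trans (+-cong (e 0 0 ≡.refl) (sumTo-0 n _ (λ i → e₀ (suc i) (s≤s z≤n)))) (+-identityʳ _)
  sumTo-antid (suc k) (suc n) f g (s≤s k≤n) e e₀ = +-cong (e 0 (suc k) ≡.refl)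
    (sumTo-antid k n _ _ k≤n (λ i j i+j≡k → e (suc i) j (≡.cong suc i+j≡k)) (λ i k<i → e₀ (suc i) (s≤s k<i)))

  -- The doubled index x = 2i, filled up with zeros at odd x, turns a sum over 2i + j = k into a
  -- full antidiagonal, the shape of a coefficient of a product.
  sumTo-spread : ∀ k n f (g : ℕ → ℕ → Carrier) → k ℕ.≤ n →
    (∀ i j → i ℕ.+ i ℕ.+ j ≡ k → f i ≈ g i j) → (∀ i → k ℕ.< i ℕ.+ i → f i ≈ 0#) →
    sumTo n f ≈ antid k (λ x j → spread (λ i → g i j) x)
  sumTo-spread zero    zero    f g z≤n e e₀ = e 0 0 ≡.refl
  sumTo-spread zero    (suc n) f g z≤n e e₀ =
    trans (+-cong (e 0 0 ≡.refl) (sumTo-0 n _ (λ i → e₀ (suc i) (s≤s z≤n)))) (+-identityʳ _)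
  sumTo-spread (suc zero) (suc n) f g k≤n e e₀ = +-cong (e 0 1 ≡.refl)
    (sumTo-0 n _ (λ i → e₀ (suc i) (≡.subst (1 ℕ.<_) (≡.sym (≡.cong suc (ℕₚ.+-suc i i))) (s≤s (s≤s z≤n)))))
  sumTo-spread (suc (suc k)) (suc n) f g (s≤s k≤n) e e₀ = +-cong (e 0 _ ≡.refl) (trans
    (sumTo-spread k n _ _ (ℕₚ.≤-trans (ℕₚ.n≤1+n k) k≤n)
      (λ i j i+i+j≡k → e (suc i) j (≡.cong suc (≡.trans (≡.cong (ℕ._+ j) (ℕₚ.+-suc i i)) (≡.cong suc i+i+j≡k))))
      (λ i k<i+i → e₀ (suc i) (s≤s (≡.subst (suc k ℕ.<_) (≡.sym (ℕₚ.+-suc i i)) (s≤s k<i+i)))))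
    (sym (+-identityˡ _)))

-- The functional equation of the generating function

module _ {c ℓ} (S : CommutativeRing c ℓ) where
  open CommutativeRing S
  open import Relation.Binary.Reasoning.Setoid setoid
  open import Algebra.Solver.Ring.NaturalCoefficients.Default commutativeSemiring
    using (solve; _:=_; _:+_; _:*_; con)

  -- The factor 1 + y that relates E₀ to E₃ and the factor 1 - y from the term moved to the right
  -- combine to 1 - y², which turns κ₀ into κ₁. The relation ab = d then lets the y² term of (1 + a
  -- y)(1 + b y) absorb the change from κ₂ to κ₁.
  functional-equation : ∀ {y a b d E₀ E₁ E₂ E₃ E₄ E₅ κ₀ κ₁ κ₂} → a * b ≈ d →
    E₀ ≈ E₃ + y * E₃ → E₁ ≈ E₄ + a * (y * E₄) → E₂ ≈ E₅ + b * (y * E₅) →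
    κ₀ ≈ κ₁ + 1# * (y * (y * κ₀)) → κ₁ ≈ κ₂ + d * (y * (y * κ₁)) →
    κ₀ * (E₀ * (E₁ * E₂)) + κ₂ * (E₃ * (E₄ * E₅)) ≈
    (κ₁ * (E₁ * E₅)) * E₃ + (κ₁ * (E₄ * E₂)) * E₃ + y * (κ₀ * (E₀ * (E₁ * E₂)))
  functional-equation {y} {a} {b} {d} {E₀} {E₁} {E₂} {E₃} {E₄} {E₅} {κ₀} {κ₁} {κ₂} ab≈d e₀ e₁ e₂ k₀ k₁ = begin
    κ₀ * (E₀ * (E₁ * E₂)) + κ₂ * (E₃ * (E₄ * E₅))
      ≈⟨ +-congʳ expand ⟩
    κ₀ * (y * X) + κ₀ * X + κ₂ * (E₃ * (E₄ * E₅))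
      -- Only the summand without y is expanded: the resulting y² κ₀ X and the untouched y κ₀ X add
      -- up to y times the first product, which is the last term of the goal.
      ≈⟨ +-congʳ (+-congˡ (*-congʳ k₀)) ⟩
    κ₀ * (y * X) + (κ₁ + 1# * (y * (y * κ₀))) * X + κ₂ * (E₃ * (E₄ * E₅))
      ≈⟨ solve 9 (λ y a b E₃ E₄ E₅ κ₀ κ₁ κ₂ →
           let X = E₃ :* ((E₄ :+ a :* (y :* E₄)) :* (E₅ :+ b :* (y :* E₅))) in
           κ₀ :* (y :* X) :+ (κ₁ :+ con 1 :* (y :* (y :* κ₀))) :* X :+ κ₂ :* (E₃ :* (E₄ :* E₅))
           := E₃ :* (E₄ :* E₅) :* (κ₁ :* (con 1 :+ a :* y :+ b :* y) :+ (κ₂ :+ a :* b :* (y :* (y :* κ₁))))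
              :+ y :* (κ₀ :* (y :* X) :+ κ₀ :* X))
           refl y a b E₃ E₄ E₅ κ₀ κ₁ κ₂ ⟩
    E₃ * (E₄ * E₅) * (κ₁ * (1# + a * y + b * y) + (κ₂ + a * b * (y * (y * κ₁)))) + y * (κ₀ * (y * X) + κ₀ * X)
      ≈⟨ +-cong (*-congˡ (+-congˡ (trans (+-congˡ (*-congʳ ab≈d)) (sym k₁)))) (*-congˡ (sym expand)) ⟩
    E₃ * (E₄ * E₅) * (κ₁ * (1# + a * y + b * y) + κ₁) + y * (κ₀ * (E₀ * (E₁ * E₂)))
      ≈⟨ +-congʳ (solve 7 (λ y a b E₃ E₄ E₅ κ₁ →
           E₃ :* (E₄ :* E₅) :* (κ₁ :* (con 1 :+ a :* y :+ b :* y) :+ κ₁)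
           := (κ₁ :* ((E₄ :+ a :* (y :* E₄)) :* E₅)) :* E₃ :+ (κ₁ :* (E₄ :* (E₅ :+ b :* (y :* E₅)))) :* E₃)
           refl y a b E₃ E₄ E₅ κ₁) ⟩
    (κ₁ * ((E₄ + a * (y * E₄)) * E₅)) * E₃ + (κ₁ * (E₄ * (E₅ + b * (y * E₅)))) * E₃ + y * (κ₀ * (E₀ * (E₁ * E₂)))
      ≈⟨ +-congʳ (+-cong (*-congʳ (*-congˡ (*-congʳ e₁))) (*-congʳ (*-congˡ (*-congˡ e₂)))) ⟨
    (κ₁ * (E₁ * E₅)) * E₃ + (κ₁ * (E₄ * E₂)) * E₃ + y * (κ₀ * (E₀ * (E₁ * E₂))) ∎
    where
    X = E₃ * ((E₄ + a * (y * E₄)) * (E₅ + b * (y * E₅)))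
    expand : κ₀ * (E₀ * (E₁ * E₂)) ≈ κ₀ * (y * X) + κ₀ * X
    expand = trans (*-congˡ (*-cong e₀ (*-cong e₁ e₂)))
      (solve 4 (λ k y e x → k :* ((e :+ y :* e) :* x) := k :* (y :* (e :* x)) :+ k :* (e :* x)) refl _ _ _ _)

-- Exponents

tri-+ : ∀ a b → tri (a ℕ.+ b) ≡ tri a ℕ.+ tri b ℕ.+ a ℕ.* b
tri-+ zero    b = ≡.sym (ℕₚ.+-identityʳ (tri b))
tri-+ (suc a) b = ≡.trans (≡.cong (a ℕ.+ b ℕ.+_) (tri-+ a b))
  (solve 4 (λ a b x y → a :+ b :+ (x :+ y :+ a :* b) := a :+ x :+ y :+ (b :+ a :* b)) ≡.refl a b (tri a) (tri b))
  where open +-*-Solver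

n*n≡2tri+n : ∀ n → n ℕ.* n ≡ tri n ℕ.+ tri n ℕ.+ n
n*n≡2tri+n zero    = ≡.refl
n*n≡2tri+n (suc n) = ≡.trans
  (solve 1 (λ n → (con 1 :+ n) :* (con 1 :+ n) := con 1 :+ n :+ n :+ n :* n) ≡.refl n)
  (≡.trans (≡.cong (suc (n ℕ.+ n) ℕ.+_) (n*n≡2tri+n n))
  (solve 2 (λ n t → con 1 :+ n :+ n :+ (t :+ t :+ n) := n :+ t :+ (n :+ t) :+ (con 1 :+ n)) ≡.refl n (tri n)))
  where open +-*-Solver

-- The truncated subtraction is exact because 2m + 3n splits off the quadratic form as a summand.
expL-tri : ∀ m n → expL m n ≡ 3 ℕ.* tri (n ℕ.+ n ℕ.+ m) ℕ.+ tri m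
expL-tri m n = ≡.trans (≡.cong (ℕ._∸ s) quadratic) (ℕₚ.m+n∸n≡m _ s)
  where
  open +-*-Solver
  open ≡.≡-Reasoning
  s = 2 ℕ.* m ℕ.+ 3 ℕ.* n
  quadratic : 2 ℕ.* m ℕ.* m ℕ.+ 6 ℕ.* m ℕ.* n ℕ.+ 6 ℕ.* n ℕ.* n ≡ 3 ℕ.* tri (n ℕ.+ n ℕ.+ m) ℕ.+ tri m ℕ.+ s
  quadratic = begin
    2 ℕ.* m ℕ.* m ℕ.+ 6 ℕ.* m ℕ.* n ℕ.+ 6 ℕ.* n ℕ.* n
      ≡⟨ solve 2 (λ m n → con 2 :* m :* m :+ con 6 :* m :* n :+ con 6 :* n :* n
           := con 2 :* (m :* m) :+ con 6 :* m :* n :+ con 3 :* (n :* n) :+ con 3 :* (n :* n)) ≡.refl m n ⟩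
    2 ℕ.* (m ℕ.* m) ℕ.+ 6 ℕ.* m ℕ.* n ℕ.+ 3 ℕ.* (n ℕ.* n) ℕ.+ 3 ℕ.* (n ℕ.* n)
      ≡⟨ ≡.cong₂ (λ x y → 2 ℕ.* x ℕ.+ 6 ℕ.* m ℕ.* n ℕ.+ 3 ℕ.* (n ℕ.* n) ℕ.+ 3 ℕ.* y) (n*n≡2tri+n m) (n*n≡2tri+n n) ⟩
    2 ℕ.* (tri m ℕ.+ tri m ℕ.+ m) ℕ.+ 6 ℕ.* m ℕ.* n ℕ.+ 3 ℕ.* (n ℕ.* n) ℕ.+ 3 ℕ.* (tri n ℕ.+ tri n ℕ.+ n)
      ≡⟨ solve 4 (λ m n x y → con 2 :* (x :+ x :+ m) :+ con 6 :* m :* n :+ con 3 :* (n :* n) :+ con 3 :* (y :+ y :+ n)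
           := con 3 :* (y :+ y :+ n :* n :+ x :+ (n :+ n) :* m) :+ x :+ (con 2 :* m :+ con 3 :* n)) ≡.refl m n (tri m) (tri n) ⟩
    3 ℕ.* (tri n ℕ.+ tri n ℕ.+ n ℕ.* n ℕ.+ tri m ℕ.+ (n ℕ.+ n) ℕ.* m) ℕ.+ tri m ℕ.+ s
      ≡⟨ ≡.cong (λ x → 3 ℕ.* x ℕ.+ tri m ℕ.+ s)
           (≡.trans (tri-+ (n ℕ.+ n) m) (≡.cong (λ x → x ℕ.+ tri m ℕ.+ (n ℕ.+ n) ℕ.* m) (tri-+ n n))) ⟨
    3 ℕ.* tri (n ℕ.+ n ℕ.+ m) ℕ.+ tri m ℕ.+ s ∎

+[n*n] : ∀ n → + n ℤ.* + n ≡ + tri n ℤ.+ + tri n ℤ.+ + n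
+[n*n] n = ≡.trans (≡.sym (ℤₚ.pos-* n n)) (≡.cong +_ (n*n≡2tri+n n))

+[6tri+] : ∀ k n → + 6 ℤ.* + tri n ℤ.+ + k ℤ.* + n ≡ + (6 ℕ.* tri n ℕ.+ k ℕ.* n)
+[6tri+] k n = ≡.cong₂ ℤ._+_ (≡.sym (ℤₚ.pos-* 6 (tri n))) (≡.sym (ℤₚ.pos-* k n))

module _ where
  open ℤ-Solver.+-*-Solver

  -- With j² = 2 tri|j| + |j|, the coefficients of |j| for j ≥ 0 and j ≤ 0 are the exponents of q in
  -- u and v: 1 and 5 for `expR`, 4 and 2 for `expR'`.
  expR-+ : ∀ n → expR (+ n) ≡ 6 ℕ.* tri n ℕ.+ 1 ℕ.* n
  expR-+ n = ≡.cong ℤ.∣_∣ (≡.trans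
    (solve 1 (λ j → con (+ 3) :* j :* j :- con (+ 2) :* j := con (+ 3) :* (j :* j) :- con (+ 2) :* j) ≡.refl (+ n))
    (≡.trans (≡.cong (λ x → + 3 ℤ.* x ℤ.- + 2 ℤ.* + n) (+[n*n] n)) (≡.trans
    (solve 2 (λ t j → con (+ 3) :* (t :+ t :+ j) :- con (+ 2) :* j := con (+ 6) :* t :+ con (+ 1) :* j) ≡.refl (+ tri n) (+ n))
    (+[6tri+] 1 n))))

  expR-neg : ∀ n → expR (ℤ.- + n) ≡ 6 ℕ.* tri n ℕ.+ 5 ℕ.* n
  expR-neg n = ≡.cong ℤ.∣_∣ (≡.trans
    (solve 1 (λ j → con (+ 3) :* (:- j) :* (:- j) :- con (+ 2) :* (:- j) := con (+ 3) :* (j :* j) :+ con (+ 2) :* j) ≡.refl (+ n))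
    (≡.trans (≡.cong (λ x → + 3 ℤ.* x ℤ.+ + 2 ℤ.* + n) (+[n*n] n)) (≡.trans
    (solve 2 (λ t j → con (+ 3) :* (t :+ t :+ j) :+ con (+ 2) :* j := con (+ 6) :* t :+ con (+ 5) :* j) ≡.refl (+ tri n) (+ n))
    (+[6tri+] 5 n))))

  expR'-+ : ∀ n → expR' (+ n) ≡ 6 ℕ.* tri n ℕ.+ 4 ℕ.* n
  expR'-+ n = ≡.cong ℤ.∣_∣ (≡.trans
    (solve 1 (λ j → con (+ 3) :* j :* j :+ j := con (+ 3) :* (j :* j) :+ j) ≡.refl (+ n))
    (≡.trans (≡.cong (λ x → + 3 ℤ.* x ℤ.+ + n) (+[n*n] n)) (≡.trans
    (solve 2 (λ t j → con (+ 3) :* (t :+ t :+ j) :+ j := con (+ 6) :* t :+ con (+ 4) :* j) ≡.refl (+ tri n) (+ n))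
    (+[6tri+] 4 n))))

  expR'-neg : ∀ n → expR' (ℤ.- + n) ≡ 6 ℕ.* tri n ℕ.+ 2 ℕ.* n
  expR'-neg n = ≡.cong ℤ.∣_∣ (≡.trans
    (solve 1 (λ j → con (+ 3) :* (:- j) :* (:- j) :+ (:- j) := con (+ 3) :* (j :* j) :- j) ≡.refl (+ n))
    (≡.trans (≡.cong (λ x → + 3 ℤ.* x ℤ.- + n) (+[n*n] n)) (≡.trans
    (solve 2 (λ t j → con (+ 3) :* (t :+ t :+ j) :- j := con (+ 6) :* t :+ con (+ 2) :* j) ≡.refl (+ tri n) (+ n))
    (+[6tri+] 2 n))))

-- The exponent of q in K when u = q^α, v = q^β and p = r = q³.
K-exponent : ℕ → ℕ → ℕ → ℕ → ℕ
K-exponent α β zero    b       = 3 ℕ.* tri b ℕ.+ β ℕ.* b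
K-exponent α β (suc a) zero    = 3 ℕ.* tri (suc a) ℕ.+ α ℕ.* suc a
K-exponent α β (suc a) (suc b) = 3 ℕ.+ K-exponent α β a b

module _ (α β : ℕ) (X : ℤ → ℕ)
  (X-+ : ∀ n → X (+ n) ≡ 6 ℕ.* tri n ℕ.+ α ℕ.* n) (X-neg : ∀ n → X (ℤ.- + n) ≡ 6 ℕ.* tri n ℕ.+ β ℕ.* n) where
  open +-*-Solver
  open ≡.≡-Reasoning

  private
    edge : ∀ b c k → 3 ℕ.* (c ℕ.* (b ℕ.+ c)) ℕ.+ (6 ℕ.* tri b ℕ.+ k) ≡
      3 ℕ.* tri (b ℕ.+ c) ℕ.+ (3 ℕ.* tri c ℕ.+ 3 ℕ.* c ℕ.+ (3 ℕ.* tri b ℕ.+ k))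
    edge b c k = begin
      3 ℕ.* (c ℕ.* (b ℕ.+ c)) ℕ.+ (6 ℕ.* tri b ℕ.+ k)
        ≡⟨ solve 4 (λ b c t k → con 3 :* (c :* (b :+ c)) :+ (con 6 :* t :+ k) := con 3 :* (c :* c) :+ (con 3 :* (b :* c) :+ con 6 :* t :+ k)) ≡.refl b c (tri b) k ⟩
      3 ℕ.* (c ℕ.* c) ℕ.+ (3 ℕ.* (b ℕ.* c) ℕ.+ 6 ℕ.* tri b ℕ.+ k)
        ≡⟨ ≡.cong (λ x → 3 ℕ.* x ℕ.+ (3 ℕ.* (b ℕ.* c) ℕ.+ 6 ℕ.* tri b ℕ.+ k)) (n*n≡2tri+n c) ⟩
      3 ℕ.* (tri c ℕ.+ tri c ℕ.+ c) ℕ.+ (3 ℕ.* (b ℕ.* c) ℕ.+ 6 ℕ.* tri b ℕ.+ k)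
        ≡⟨ solve 5 (λ b c s t k → con 3 :* (s :+ s :+ c) :+ (con 3 :* (b :* c) :+ con 6 :* t :+ k)
             := con 3 :* (t :+ s :+ b :* c) :+ (con 3 :* s :+ con 3 :* c :+ (con 3 :* t :+ k))) ≡.refl b c (tri c) (tri b) k ⟩
      3 ℕ.* (tri b ℕ.+ tri c ℕ.+ b ℕ.* c) ℕ.+ (3 ℕ.* tri c ℕ.+ 3 ℕ.* c ℕ.+ (3 ℕ.* tri b ℕ.+ k))
        ≡⟨ ≡.cong (λ x → 3 ℕ.* x ℕ.+ (3 ℕ.* tri c ℕ.+ 3 ℕ.* c ℕ.+ (3 ℕ.* tri b ℕ.+ k))) (tri-+ b c) ⟨
      3 ℕ.* tri (b ℕ.+ c) ℕ.+ (3 ℕ.* tri c ℕ.+ 3 ℕ.* c ℕ.+ (3 ℕ.* tri b ℕ.+ k)) ∎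

  -- Lowering a and b together leaves a - b fixed, changes the exponent of K by 3 and both sides by
  -- the same amount; what remains is the case where a or b is zero, covered by `edge`.
  exponents-agree : ∀ a b c →
    3 ℕ.* (a ℕ.* b) ℕ.+ (3 ℕ.* ((b ℕ.+ c) ℕ.* (a ℕ.+ c)) ℕ.+ X (a ⊖ b)) ≡
    3 ℕ.* tri (a ℕ.+ b ℕ.+ c) ℕ.+ (3 ℕ.* tri c ℕ.+ 3 ℕ.* c ℕ.+ K-exponent α β a b)
  exponents-agree zero b c = ≡.trans
    (≡.cong₂ ℕ._+_ (≡.cong (3 ℕ.*_) (ℕₚ.*-comm (b ℕ.+ c) c)) (≡.trans (≡.cong X (ℤₚ.⊖-≤ {0} {b} z≤n)) (X-neg b)))
    (edge b c (β ℕ.* b))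
  exponents-agree (suc a) zero c = ≡.trans
    (≡.cong₂ ℕ._+_ (≡.cong (3 ℕ.*_) (ℕₚ.*-zeroʳ (suc a))) (≡.cong (3 ℕ.* (c ℕ.* (suc a ℕ.+ c)) ℕ.+_) (X-+ (suc a))))
    (≡.trans (edge (suc a) c (α ℕ.* suc a))
    (≡.cong (λ x → 3 ℕ.* tri (x ℕ.+ c) ℕ.+ (3 ℕ.* tri c ℕ.+ 3 ℕ.* c ℕ.+ K-exponent α β (suc a) 0)) (≡.sym (ℕₚ.+-identityʳ (suc a)))))
  exponents-agree (suc a) (suc b) c = begin
    3 ℕ.* (suc a ℕ.* suc b) ℕ.+ (3 ℕ.* ((suc b ℕ.+ c) ℕ.* (suc a ℕ.+ c)) ℕ.+ X (suc a ⊖ suc b))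
      ≡⟨ ≡.cong (λ x → 3 ℕ.* (suc a ℕ.* suc b) ℕ.+ (3 ℕ.* ((suc b ℕ.+ c) ℕ.* (suc a ℕ.+ c)) ℕ.+ X x)) (ℤₚ.[1+m]⊖[1+n]≡m⊖n a b) ⟩
    3 ℕ.* (suc a ℕ.* suc b) ℕ.+ (3 ℕ.* ((suc b ℕ.+ c) ℕ.* (suc a ℕ.+ c)) ℕ.+ X (a ⊖ b))
      ≡⟨ solve 4 (λ a b c x → con 3 :* ((con 1 :+ a) :* (con 1 :+ b)) :+ (con 3 :* ((con 1 :+ b :+ c) :* (con 1 :+ a :+ c)) :+ x)
           := con 6 :* (a :+ b :+ c) :+ con 6 :+ (con 3 :* (a :* b) :+ (con 3 :* ((b :+ c) :* (a :+ c)) :+ x))) ≡.refl a b c _ ⟩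
    6 ℕ.* n ℕ.+ 6 ℕ.+ (3 ℕ.* (a ℕ.* b) ℕ.+ (3 ℕ.* ((b ℕ.+ c) ℕ.* (a ℕ.+ c)) ℕ.+ X (a ⊖ b)))
      ≡⟨ ≡.cong (6 ℕ.* n ℕ.+ 6 ℕ.+_) (exponents-agree a b c) ⟩
    6 ℕ.* n ℕ.+ 6 ℕ.+ (3 ℕ.* tri n ℕ.+ (3 ℕ.* tri c ℕ.+ 3 ℕ.* c ℕ.+ K-exponent α β a b))
      ≡⟨ solve 4 (λ n t c k → con 6 :* n :+ con 6 :+ (con 3 :* t :+ (c :+ k))
           := con 3 :* (con 1 :+ n :+ (n :+ t)) :+ (c :+ (con 3 :+ k))) ≡.refl n (tri n) (3 ℕ.* tri c ℕ.+ 3 ℕ.* c) _ ⟩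
    3 ℕ.* tri (suc (suc n)) ℕ.+ (3 ℕ.* tri c ℕ.+ 3 ℕ.* c ℕ.+ K-exponent α β (suc a) (suc b))
      ≡⟨ ≡.cong (λ x → 3 ℕ.* tri (suc (x ℕ.+ c)) ℕ.+ (3 ℕ.* tri c ℕ.+ 3 ℕ.* c ℕ.+ K-exponent α β (suc a) (suc b))) (ℕₚ.+-suc a b) ⟨
    3 ℕ.* tri (suc a ℕ.+ suc b ℕ.+ c) ℕ.+ (3 ℕ.* tri c ℕ.+ 3 ℕ.* c ℕ.+ K-exponent α β (suc a) (suc b)) ∎
    where n = a ℕ.+ b ℕ.+ c

cancel-⊖ : ∀ a b c n → b ℕ.+ c ℕ.≤ n → (a ℕ.+ c ℕ.+ (n ∸ (b ℕ.+ c))) ⊖ n ≡ a ⊖ b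
cancel-⊖ a b c n b+c≤n = begin
  (a ℕ.+ c ℕ.+ d) ⊖ n                ≡⟨ ≡.cong ((a ℕ.+ c ℕ.+ d) ⊖_) (ℕₚ.m+[n∸m]≡n b+c≤n) ⟨
  (a ℕ.+ c ℕ.+ d) ⊖ (b ℕ.+ c ℕ.+ d)  ≡⟨ ≡.cong₂ _⊖_ (move a) (move b) ⟩
  (c ℕ.+ d ℕ.+ a) ⊖ (c ℕ.+ d ℕ.+ b)  ≡⟨ ℤₚ.+-cancelˡ-⊖ (c ℕ.+ d) a b ⟩
  a ⊖ b                              ∎
  where
  open ≡.≡-Reasoning
  d = n ∸ (b ℕ.+ c)
  move : ∀ x → x ℕ.+ c ℕ.+ d ≡ c ℕ.+ d ℕ.+ x
  move x = ≡.trans (ℕₚ.+-assoc x c d) (ℕₚ.+-comm x (c ℕ.+ d))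

-- Base q³

module Dilation {c ℓ} (R : CommutativeRing c ℓ) (p : CommutativeRing.Carrier R)
  (geom : ℕ → CommutativeRing.Carrier R) (geom-eq : GeometricInverses R p geom) where
  open CommutativeRing R
  open Antidiagonal R
  open PowerSeries R
  open Monomials R
  open Base R p geom geom-eq
  open import Algebra.Properties.Semiring.Exp semiring using (_^_; ^-congˡ; ^-homo-*)
  open import Algebra.Properties.CommutativeSemiring.Exp commutativeSemiring using (^-distrib-*)
  open import Algebra.Properties.Group +-group using (∙-cancelʳ)
  open import Relation.Binary.Reasoning.Setoid setoid
  open import Algebra.Solver.Ring.NaturalCoefficients.Default commutativeSemiring
    using (solve; _:=_; _:+_; _:*_; con)

  E-cong : ∀ {u v} → u ≈ v → ∀ n → E u n ≈ E v n
  E-cong u≈v n = *-congˡ (*-congʳ (^-congˡ n u≈v))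

  scale-E : ∀ s u n → scale s (E u) n ≈ E (s * u) n
  scale-E s u n = trans
    (solve 4 (λ s t u i → s :* (t :* (u :* i)) := t :* (s :* u :* i)) refl _ _ _ _)
    (*-congˡ (*-congʳ (sym (^-distrib-* s u n))))

  scale-κ : ∀ s r n → s ^ n * κ r n ≈ κ (s * r) n
  scale-κ s r n = trans (sym (*-assoc _ _ _)) (*-congʳ (sym (^-distrib-* s r n)))

  -- `E-suc` with the dilation y -> p y absorbed into the parameter: E_u(y) = (1 + u y) E_{pu}(y).
  E-shift : ∀ u n → E u n ≈ E (p * u) n + (C u ⊛ (Y ⊛ E (p * u))) n
  E-shift u zero = solve 2 (λ u x → con 1 :* (con 1 :* con 1) := con 1 :* (con 1 :* con 1) :+ u :* (con 0 :* x))
    refl u (E (p * u) 0)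
  E-shift u (suc n) = begin
    E u (suc n)                                                    ≈⟨ E-suc u n ⟩
    p ^ n * u * E u n + scale p (E u) (suc n)                      ≈⟨ +-congʳ (solve 3 (λ a u e → a :* u :* e := u :* (a :* e)) refl _ _ _) ⟩
    u * scale p (E u) n + scale p (E u) (suc n)                    ≈⟨ +-cong (*-congˡ (scale-E p u n)) (scale-E p u (suc n)) ⟩
    u * E (p * u) n + E (p * u) (suc n)                            ≈⟨ +-comm _ _ ⟩
    E (p * u) (suc n) + u * E (p * u) n                            ≈⟨ +-congˡ (*-congˡ (Y-⊛-suc (E (p * u)) n)) ⟨
    E (p * u) (suc n) + u * (Y ⊛ E (p * u)) (suc n)                ≈⟨ +-congˡ (C-⊛ u (Y ⊛ E (p * u)) (suc n)) ⟨
    E (p * u) (suc n) + (C u ⊛ (Y ⊛ E (p * u))) (suc n)            ∎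

  κ-shift : ∀ r n → spread (κ r) n ≈ spread (κ (p * r)) n + (C r ⊛ (Y ⊛ (Y ⊛ spread (κ r)))) n
  κ-shift r = spread-recurrence r (κ r) (κ (p * r)) refl λ n → begin
    r * r ^ n * I (suc n)                                    ≈⟨ *-congˡ (I-suc n) ⟩
    r * r ^ n * (I n + p ^ suc n * I (suc n))
      ≈⟨ solve 5 (λ r s i t j → r :* s :* (i :+ t :* j) := t :* (r :* s :* j) :+ r :* (s :* i)) refl _ _ _ _ _ ⟩
    p ^ suc n * κ r (suc n) + r * κ r n                      ≈⟨ +-congʳ (scale-κ p r (suc n)) ⟩
    κ (p * r) (suc n) + r * κ r n                            ∎

  -- Since p^n I(n) = I(n) - I(n-1), the factor p^n acts on the series f as f(p y) - y f(y) does.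
  antid-*1+p^n : ∀ n (f h : Series) → (∀ l → f l + scale p f l ≈ h l + (Y ⊛ f) l) →
    antid n (λ l e → I e * (p ^ tri l * f l)) * (1# + p ^ n) ≈ antid n (λ l e → I e * (p ^ tri l * h l))
  antid-*1+p^n n f h eq = ∙-cancelʳ (Σ (Y ⊛ f)) _ _ (begin
    Σ f * (1# + p ^ n) + Σ (Y ⊛ f)     ≈⟨ solve 3 (λ a t b → a :* (con 1 :+ t) :+ b := a :+ (t :* a :+ b)) refl _ _ _ ⟩
    Σ f + (p ^ n * Σ f + Σ (Y ⊛ f))    ≈⟨ +-congˡ (dilate n) ⟩
    Σ f + Σ (scale p f)                ≈⟨ Σ-+ f (scale p f) ⟨
    Σ (λ l → f l + scale p f l)        ≈⟨ antid-cong n (λ l e _ → *-congˡ (*-congˡ (eq l))) ⟩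
    Σ (λ l → h l + (Y ⊛ f) l)          ≈⟨ Σ-+ h (Y ⊛ f) ⟩
    Σ h + Σ (Y ⊛ f)                    ∎)
    where
    Σ : Series → Carrier
    Σ k = antid n (λ l e → I e * (p ^ tri l * k l))
    Σ-+ : ∀ k k′ → Σ (λ l → k l + k′ l) ≈ Σ k + Σ k′
    Σ-+ k k′ = trans
      (antid-cong n (λ l e _ → solve 4 (λ i t x y → i :* (t :* (x :+ y)) := i :* (t :* x) :+ i :* (t :* y)) refl _ _ (k l) (k′ l)))
      (antid-+ n _ _)
    dilate : ∀ n → p ^ n * antid n (λ l e → I e * (p ^ tri l * f l)) + antid n (λ l e → I e * (p ^ tri l * (Y ⊛ f) l)) ≈
      antid n (λ l e → I e * (p ^ tri l * scale p f l))
    dilate zero = solve 3 (λ i t x → con 1 :* (i :* (t :* x)) :+ i :* (t :* (con 0 :* x)) := i :* (t :* (con 1 :* x))) refl (I 0) (p ^ 0) (f 0)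
    dilate (suc n) = begin
      p ^ suc n * antid (suc n) (λ l e → I e * (p ^ tri l * f l)) +
        (I (suc n) * (p ^ 0 * (0# * f 0)) + antid n (λ l e → I e * (p ^ (l ℕ.+ tri l) * (Y ⊛ f) (suc l))))
        ≈⟨ +-cong (*-congˡ (antid-last n (λ l e → I e * (p ^ tri l * f l))))
             (trans (+-congʳ (solve 2 (λ i x → i :* (con 1 :* (con 0 :* x)) := con 0) refl _ _)) (+-identityˡ _)) ⟩
      p ^ suc n * (antid n (λ l e → I (suc e) * (p ^ tri l * f l)) + I 0 * (p ^ tri (suc n) * f (suc n)))
        + antid n (λ l e → I e * (p ^ (l ℕ.+ tri l) * (Y ⊛ f) (suc l)))
        ≈⟨ solve 4 (λ t a b c → t :* (a :+ b) :+ c := t :* a :+ c :+ t :* b) refl _ _ _ _ ⟩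
      p ^ suc n * antid n (λ l e → I (suc e) * (p ^ tri l * f l))
        + antid n (λ l e → I e * (p ^ (l ℕ.+ tri l) * (Y ⊛ f) (suc l))) + p ^ suc n * (I 0 * (p ^ tri (suc n) * f (suc n)))
        ≈⟨ +-cong (trans (+-congʳ (sym (antid-*ˡ n _ _))) (sym (antid-+ n _ _)))
             (solve 4 (λ s i t x → s :* (i :* (t :* x)) := i :* (t :* (s :* x))) refl _ _ _ _) ⟩
      antid n (λ l e → p ^ suc n * (I (suc e) * (p ^ tri l * f l)) + I e * (p ^ (l ℕ.+ tri l) * (Y ⊛ f) (suc l)))
        + I 0 * (p ^ tri (suc n) * scale p f (suc n))
        ≈⟨ +-congʳ (antid-cong n step) ⟩
      antid n (λ l e → I (suc e) * (p ^ tri l * scale p f l)) + I 0 * (p ^ tri (suc n) * scale p f (suc n))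
        ≈⟨ antid-last n (λ l e → I e * (p ^ tri l * scale p f l)) ⟨
      antid (suc n) (λ l e → I e * (p ^ tri l * scale p f l)) ∎
      where
      -- Multiplication by y moves the coefficient f(l) to index l+1, where tri(l+1) = l + tri(l)
      -- supplies the very p^l that the dilation needs.
      step : ∀ l e → l ℕ.+ e ≡ n →
        p ^ suc n * (I (suc e) * (p ^ tri l * f l)) + I e * (p ^ (l ℕ.+ tri l) * (Y ⊛ f) (suc l)) ≈
        I (suc e) * (p ^ tri l * scale p f l)
      step l e ≡.refl = begin
        p ^ suc (l ℕ.+ e) * (I (suc e) * (p ^ tri l * f l)) + I e * (p ^ (l ℕ.+ tri l) * (Y ⊛ f) (suc l))
          ≈⟨ +-cong (*-congʳ (*-congˡ (^-homo-* p l e))) (*-congˡ (*-cong (^-homo-* p l (tri l)) (Y-⊛-suc f l))) ⟩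
        p * (p ^ l * p ^ e) * (I (suc e) * (p ^ tri l * f l)) + I e * (p ^ l * p ^ tri l * f l)
          ≈⟨ solve 7 (λ p a b i j t x → p :* (a :* b) :* (i :* (t :* x)) :+ j :* (a :* t :* x) := (j :+ p :* b :* i) :* (t :* (a :* x)))
               refl _ _ _ _ _ _ _ ⟩
        (I e + p ^ suc e * I (suc e)) * (p ^ tri l * scale p f l)
          ≈⟨ *-congʳ (I-suc e) ⟨
        I (suc e) * (p ^ tri l * scale p f l) ∎

-- The finite identity, with bases q and q³ side by side

module Cubic {c ℓ} (R : CommutativeRing c ℓ) (q : CommutativeRing.Carrier R)
  (geom : ℕ → CommutativeRing.Carrier R) (geom-eq : GeometricInverses R q geom) where
  open CommutativeRing R
  open Antidiagonal R
  open PowerSeries R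
  open Monomials R
  open import Algebra.Properties.Semiring.Exp semiring using (_^_; ^-congˡ; ^-congʳ; ^-homo-*; ^-assocʳ)
  open import Relation.Binary.Reasoning.Setoid setoid
  open import Algebra.Solver.Ring.NaturalCoefficients.Default commutativeSemiring
    using (solve; _:=_; _:+_; _:*_; con)

  p : Carrier
  p = q ^ 3

  -- The inverse of 1 - q^(3(n+1)). As `geom` counts from zero, the index is one less than
  -- `3 * suc n`, written so that its successor is this product definitionally.
  geom³ : ℕ → Carrier
  geom³ n = geom (n ℕ.+ 2 ℕ.* suc n)

  geom³-eq : GeometricInverses R p geom³
  geom³-eq n = trans (geom-eq _) (+-congˡ (*-congʳ (sym (^-assocʳ q 3 (suc n)))))

  module Q = Base R q geom geom-eq
  open Base R p geom³ geom³-eq public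
  open Dilation R p geom³ geom³-eq

  private
    module 𝕊 = CommutativeRing seriesRing

  -- The dilation y -> q y carries E_1, E_q, E_{q²} to E_q, E_{q²}, E_{q³}, so the product satisfies
  -- f(y) = (1 + y) f(q y). This is the base-q equation of (-y; q)_∞, and `Q.unique` identifies the
  -- coefficients.
  Euler-product : ∀ n → (E 1# ⊛ (E q ⊛ E (q * q))) n ≈ Q.E 1# n
  Euler-product zero =
    solve 0 (con 1 :* (con 1 :* con 1) :* (con 1 :* (con 1 :* con 1) :* (con 1 :* (con 1 :* con 1))) := con 1 :* (con 1 :* con 1)) refl
  Euler-product (suc n) = Q.unique n
    (begin
      f (suc n)                                                 ≈⟨ f-shift (suc n) ⟩
      scale q f (suc n) + (Y ⊛ scale q f) (suc n)               ≈⟨ +-comm _ _ ⟩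
      (Y ⊛ scale q f) (suc n) + scale q f (suc n)               ≈⟨ +-congʳ (Y-⊛-suc (scale q f) n) ⟩
      scale q f n + scale q f (suc n)                           ≈⟨ +-congʳ (*-cong (sym (*-identityʳ _)) (Euler-product n)) ⟩
      q ^ n * 1# * Q.E 1# n + q ^ suc n * f (suc n)             ∎)
    (Q.E-suc 1# n)
    where
    f : Series
    f = E 1# ⊛ (E q ⊛ E (q * q))
    q³ : q * (q * q) ≈ p * 1#
    q³ = solve 1 (λ q → q :* (q :* q) := q :* (q :* (q :* con 1)) :* con 1) refl q
    scale-f : ∀ n → scale q f n ≈ (E (p * 1#) ⊛ (E q ⊛ E (q * q))) n
    scale-f n = begin
      scale q f n
        ≈⟨ scale-⊛ q (E 1#) (E q ⊛ E (q * q)) n ⟩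
      (scale q (E 1#) ⊛ scale q (E q ⊛ E (q * q))) n
        ≈⟨ 𝕊.*-cong (λ k → trans (scale-E q 1# k) (E-cong (*-identityʳ q) k))
             (λ k → trans (scale-⊛ q (E q) (E (q * q)) k) (𝕊.*-cong (scale-E q q) (λ j → trans (scale-E q (q * q) j) (E-cong q³ j)) k)) n ⟩
      (E q ⊛ (E (q * q) ⊛ E (p * 1#))) n
        ≈⟨ 𝕊.sym (𝕊.*-assoc (E q) (E (q * q)) (E (p * 1#))) n ⟩
      ((E q ⊛ E (q * q)) ⊛ E (p * 1#)) n
        ≈⟨ ⊛-comm (E q ⊛ E (q * q)) (E (p * 1#)) n ⟩
      (E (p * 1#) ⊛ (E q ⊛ E (q * q))) n ∎
    f-shift : ∀ n → f n ≈ scale q f n + (Y ⊛ scale q f) n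
    f-shift n = begin
      f n
        ≈⟨ 𝕊.*-congʳ {x = E q ⊛ E (q * q)} (λ k → trans (E-shift 1# k) (+-congˡ (trans (C-⊛ 1# (Y ⊛ E (p * 1#)) k) (*-identityˡ _)))) n ⟩
      ((λ k → E (p * 1#) k + (Y ⊛ E (p * 1#)) k) ⊛ (E q ⊛ E (q * q))) n
        ≈⟨ 𝕊.distribʳ (E q ⊛ E (q * q)) (E (p * 1#)) (Y ⊛ E (p * 1#)) n ⟩
      (E (p * 1#) ⊛ (E q ⊛ E (q * q))) n + ((Y ⊛ E (p * 1#)) ⊛ (E q ⊛ E (q * q))) n
        ≈⟨ +-cong (sym (scale-f n)) (trans (⊛-assoc Y (E (p * 1#)) (E q ⊛ E (q * q)) n) (𝕊.*-congˡ {x = Y} (λ k → sym (scale-f k)) n)) ⟩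
      scale q f n + (Y ⊛ scale q f) n ∎

  -- (-y; q)_∞ / (y²; q³)_∞: the exponent of y is 2n + m for the summation indices of the double
  -- sum.
  capparelli : Series
  capparelli = spread (κ 1#) ⊛ Q.E 1#

  H₁ H₂ : Series
  H₁ = (spread (κ (p * 1#)) ⊛ (E q ⊛ E (p * (q * q)))) ⊛ E (p * 1#)
  H₂ = (spread (κ (p * 1#)) ⊛ (E (p * q) ⊛ E (q * q))) ⊛ E (p * 1#)

  capparelli-dilation : ∀ l →
    capparelli l + scale p capparelli l ≈ (H₁ l + H₂ l) + (Y ⊛ capparelli) l
  capparelli-dilation l = begin
    capparelli l + scale p capparelli l
      ≈⟨ +-cong (capparelli-product l) (trans (*-congˡ (capparelli-product l)) (scaled l)) ⟩
    g l + (spread (κ (p * (p * 1#))) ⊛ (E (p * 1#) ⊛ (E (p * q) ⊛ E (p * (q * q))))) l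
      ≈⟨ functional-equation seriesRing {Y} {C q} {C (q * q)} {C (p * 1#)} {E 1#} {E q} {E (q * q)}
           {E (p * 1#)} {E (p * q)} {E (p * (q * q))} {spread (κ 1#)} {spread (κ (p * 1#))} {spread (κ (p * (p * 1#)))}
           C-q³
           (λ n → trans (E-shift 1# n) (+-congˡ (trans (C-⊛ 1# (Y ⊛ E (p * 1#)) n) (*-identityˡ _))))
           (E-shift q) (E-shift (q * q))
           (λ n → trans (κ-shift 1# n) (+-congˡ (trans (C-⊛ 1# (Y ⊛ (Y ⊛ spread (κ 1#))) n)
             (trans (*-identityˡ _) (sym (one-⊛ (Y ⊛ (Y ⊛ spread (κ 1#))) n))))))
           (κ-shift (p * 1#)) l ⟩
    (H₁ l + H₂ l) + (Y ⊛ g) l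
      ≈⟨ +-congˡ (𝕊.*-congˡ {x = Y} (λ n → sym (capparelli-product n)) l) ⟩
    (H₁ l + H₂ l) + (Y ⊛ capparelli) l ∎
    where
    g : Series
    g = spread (κ 1#) ⊛ (E 1# ⊛ (E q ⊛ E (q * q)))
    capparelli-product : ∀ n → capparelli n ≈ g n
    capparelli-product = 𝕊.*-congˡ {x = spread (κ 1#)} (λ n → sym (Euler-product n))
    scaled : ∀ n → scale p g n ≈ (spread (κ (p * (p * 1#))) ⊛ (E (p * 1#) ⊛ (E (p * q) ⊛ E (p * (q * q))))) n
    scaled n = trans (scale-⊛ p (spread (κ 1#)) (E 1# ⊛ (E q ⊛ E (q * q))) n) (𝕊.*-cong
      (λ k → trans (scale-spread p (κ 1#) k) (spread-cong (λ i → trans (scale-κ (p * p) 1# i) (*-congʳ (^-congˡ i (*-assoc p p 1#)))) k))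
      (λ k → trans (scale-⊛ p (E 1#) (E q ⊛ E (q * q)) k) (𝕊.*-cong (scale-E p 1#)
        (λ j → trans (scale-⊛ p (E q) (E (q * q)) j) (𝕊.*-cong (scale-E p q) (scale-E p (q * q)) j)) k)) n)
    C-q³ : ∀ n → (C q ⊛ C (q * q)) n ≈ C (p * 1#) n
    C-q³ zero    = solve 1 (λ q → q :* (q :* q) := q :* (q :* (q :* con 1)) :* con 1) refl q
    C-q³ (suc n) = trans (C-⊛ q (C (q * q)) (suc n)) (zeroʳ q)

  p^≈q^ : ∀ n → p ^ n ≈ q ^ (3 ℕ.* n)
  p^≈q^ = ^-assocʳ q 3

  module _ {u v r : Carrier} (uv≈pr : u * v ≈ p * r) (α β : ℕ) (u≈q^α : u ≈ q ^ α) (v≈q^β : v ≈ q ^ β) (r≈p : r ≈ p) where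

    private
      power : ∀ n {w} γ → w ≈ q ^ γ → p ^ tri n * w ^ n ≈ q ^ (3 ℕ.* tri n ℕ.+ γ ℕ.* n)
      power n γ w≈q^γ = trans
        (*-cong (p^≈q^ (tri n)) (trans (^-congˡ n w≈q^γ) (^-assocʳ q γ n)))
        (sym (^-homo-* q (3 ℕ.* tri n) (γ ℕ.* n)))

    K≈q^ : ∀ a b → K u v r uv≈pr a b ≈ q ^ K-exponent α β a b
    K≈q^ zero    b       = power b β v≈q^β
    K≈q^ (suc a) zero    = power (suc a) α u≈q^α
    K≈q^ (suc a) (suc b) = trans (*-cong r≈p (K≈q^ a b)) (sym (^-homo-* q 3 (K-exponent α β a b)))

    -- All weights are powers of q, so the hypothesis of `T-double` comes down to an equation
    -- between natural exponents.
    T-q^ : ∀ (X : ℤ → ℕ) →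
      (∀ n → X (+ n) ≡ 6 ℕ.* tri n ℕ.+ α ℕ.* n) → (∀ n → X (ℤ.- + n) ≡ 6 ℕ.* tri n ℕ.+ β ℕ.* n) → ∀ n →
      T (n ℕ.+ n) (λ i → q ^ X (i ⊖ n)) ≈
      P n * antid n (λ l e → I e * (p ^ tri l * ((spread (κ r) ⊛ (E u ⊛ E v)) ⊛ E p) l))
    T-q^ X X-+ X-neg n = T-double u v r uv≈pr n _ weight
      where
      weight : ∀ a b c → b ℕ.+ c ℕ.≤ n →
        p ^ (a ℕ.* b) * (p ^ ((b ℕ.+ c) ℕ.* (a ℕ.+ c)) * q ^ X ((a ℕ.+ c ℕ.+ (n ∸ (b ℕ.+ c))) ⊖ n)) ≈
        p ^ tri (a ℕ.+ b ℕ.+ c) * (p ^ tri c * p ^ c * K u v r uv≈pr a b)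
      weight a b c b+c≤n = begin
        p ^ (a ℕ.* b) * (p ^ ((b ℕ.+ c) ℕ.* (a ℕ.+ c)) * q ^ X ((a ℕ.+ c ℕ.+ (n ∸ (b ℕ.+ c))) ⊖ n))
          ≈⟨ *-cong (p^≈q^ (a ℕ.* b)) (*-cong (p^≈q^ ((b ℕ.+ c) ℕ.* (a ℕ.+ c)))
               (^-congʳ q (≡.cong X (cancel-⊖ a b c n b+c≤n)))) ⟩
        q ^ (3 ℕ.* (a ℕ.* b)) * (q ^ (3 ℕ.* ((b ℕ.+ c) ℕ.* (a ℕ.+ c))) * q ^ X (a ⊖ b))
          ≈⟨ trans (^-homo-* q (3 ℕ.* (a ℕ.* b)) _) (*-congˡ (^-homo-* q (3 ℕ.* ((b ℕ.+ c) ℕ.* (a ℕ.+ c))) _)) ⟨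
        q ^ (3 ℕ.* (a ℕ.* b) ℕ.+ (3 ℕ.* ((b ℕ.+ c) ℕ.* (a ℕ.+ c)) ℕ.+ X (a ⊖ b)))
          ≈⟨ ^-congʳ q (exponents-agree α β X X-+ X-neg a b c) ⟩
        q ^ (3 ℕ.* tri (a ℕ.+ b ℕ.+ c) ℕ.+ (3 ℕ.* tri c ℕ.+ 3 ℕ.* c ℕ.+ K-exponent α β a b))
          ≈⟨ trans (^-homo-* q (3 ℕ.* tri (a ℕ.+ b ℕ.+ c)) _) (*-congˡ
               (trans (^-homo-* q (3 ℕ.* tri c ℕ.+ 3 ℕ.* c) _) (*-congʳ (^-homo-* q (3 ℕ.* tri c) (3 ℕ.* c))))) ⟩
        q ^ (3 ℕ.* tri (a ℕ.+ b ℕ.+ c)) * (q ^ (3 ℕ.* tri c) * q ^ (3 ℕ.* c) * q ^ K-exponent α β a b)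
          ≈⟨ *-cong (p^≈q^ (tri (a ℕ.+ b ℕ.+ c))) (*-cong (*-cong (p^≈q^ (tri c)) (p^≈q^ c)) (K≈q^ a b)) ⟨
        p ^ tri (a ℕ.+ b ℕ.+ c) * (p ^ tri c * p ^ c * K u v r uv≈pr a b) ∎

  finite-identity : ∀ n →
    P n * antid n (λ l e → I e * (p ^ tri l * capparelli l)) * (1# + p ^ n) ≈
    T (n ℕ.+ n) (λ i → q ^ expR (i ⊖ n) + q ^ expR' (i ⊖ n))
  finite-identity n = begin
    P n * Σ capparelli * (1# + p ^ n)
      ≈⟨ *-assoc _ _ _ ⟩
    P n * (Σ capparelli * (1# + p ^ n))
      ≈⟨ *-congˡ (antid-*1+p^n n capparelli (λ l → H₁ l + H₂ l) capparelli-dilation) ⟩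
    P n * Σ (λ l → H₁ l + H₂ l)
      ≈⟨ *-congˡ (trans (antid-cong n (λ l e _ →
           solve 4 (λ i t x y → i :* (t :* (x :+ y)) := i :* (t :* x) :+ i :* (t :* y)) refl _ _ (H₁ l) (H₂ l))) (antid-+ n _ _)) ⟩
    P n * (Σ H₁ + Σ H₂)
      ≈⟨ distribˡ _ _ _ ⟩
    P n * Σ H₁ + P n * Σ H₂
      ≈⟨ +-cong
           (trans (T-q^ (solve 1 (λ q → q :* (p′ q :* (q :* q)) := p′ q :* (p′ q :* con 1)) refl q) 1 5
             (solve 1 (λ q → q := q :* con 1) refl q)
             (solve 1 (λ q → p′ q :* (q :* q) := q :* (q :* (q :* (q :* (q :* con 1))))) refl q)
             (*-identityʳ p) expR expR-+ expR-neg n) (fix _))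
           (trans (T-q^ (solve 1 (λ q → p′ q :* q :* (q :* q) := p′ q :* (p′ q :* con 1)) refl q) 4 2
             (solve 1 (λ q → p′ q :* q := q :* (q :* (q :* (q :* con 1)))) refl q)
             (solve 1 (λ q → q :* q := q :* (q :* con 1)) refl q)
             (*-identityʳ p) expR' expR'-+ expR'-neg n) (fix _)) ⟨
    T (n ℕ.+ n) (λ i → q ^ expR (i ⊖ n)) + T (n ℕ.+ n) (λ i → q ^ expR' (i ⊖ n))
      ≈⟨ T-+ (n ℕ.+ n) _ _ ⟨
    T (n ℕ.+ n) (λ i → q ^ expR (i ⊖ n) + q ^ expR' (i ⊖ n)) ∎
    where
    open import Algebra.Solver.Ring.NaturalCoefficients.Default commutativeSemiring using (Polynomial)
    p′ : Polynomial 1 → Polynomial 1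
    p′ q = q :* (q :* (q :* con 1))
    Σ : Series → Carrier
    Σ k = antid n (λ l e → I e * (p ^ tri l * k l))
    -- `T-double` produces E_p with parameter `p`, whereas shifting `E 1#` produces it with
    -- parameter `p * 1#`.
    fix : ∀ f → P n * Σ (f ⊛ E p) ≈ P n * Σ (f ⊛ E (p * 1#))
    fix f = *-congˡ (antid-cong n (λ l e _ → *-congˡ (*-congˡ
      (𝕊.*-congˡ {x = f} (E-cong (sym (*-identityʳ p))) l))))

  -- With e = N - 2n - m the double sum runs over x + m + e = N, where x = 2n. Regrouping by l = x +
  -- m leaves, for each l, the coefficient of y^l in a product of a series in y² and (-y; q)_∞.
  sum-of-products : ∀ N (f : ℕ → ℕ → Carrier) →
    (∀ n m e → n ℕ.+ n ℕ.+ (m ℕ.+ e) ≡ N → f n m ≈ q ^ expL m n * (P N * (Q.I m * (I n * I e)))) →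
    (∀ n m → N ℕ.< n ℕ.+ n ℕ.+ m → f n m ≈ 0#) →
    sumTo N (λ n → sumTo N (f n)) ≈ P N * antid N (λ l e → I e * (p ^ tri l * capparelli l))
  sum-of-products N f f-in f-out = begin
    sumTo N (λ n → sumTo N (f n))
      ≈⟨ sumTo-spread N N _ (λ n k → antid k (g n)) ℕₚ.≤-refl
           (λ n k n+n+k≡N → sumTo-antid k N _ (g n) (ℕₚ.m+n≤o⇒n≤o (n ℕ.+ n) (ℕₚ.≤-reflexive n+n+k≡N))
             (λ m e m+e≡k → f-in n m e (≡.trans (≡.cong (n ℕ.+ n ℕ.+_) m+e≡k) n+n+k≡N))
             (λ m k<m → f-out n m (≡.subst (ℕ._< n ℕ.+ n ℕ.+ m) n+n+k≡N (ℕₚ.+-monoʳ-< (n ℕ.+ n) k<m))))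
           (λ n N<n+n → sumTo-0 N _ (λ m → f-out n m (ℕₚ.<-≤-trans N<n+n (ℕₚ.m≤m+n (n ℕ.+ n) m)))) ⟩
    antid N (λ x k → spread (λ n → antid k (g n)) x)
      ≈⟨ antid-cong N (λ x k _ → spread-antid k x g) ⟩
    antid N (λ x k → antid k (λ m e → spread (λ n → g n m e) x))
      ≈⟨ antid-assoc N (λ x m e → spread (λ n → g n m e) x) ⟨
    antid N (λ l e → antid l (λ x m → spread (λ n → g n m e) x))
      ≈⟨ antid-cong N (λ l e _ → trans (antid-cong l (λ x m x+m≡l → term l x m e x+m≡l)) (antid-*ˡ l _ _)) ⟩
    antid N (λ l e → P N * I e * p ^ tri l * capparelli l)
      ≈⟨ antid-cong N (λ l e _ → solve 4 (λ a b c d → a :* b :* c :* d := a :* (b :* (c :* d))) refl _ _ _ _) ⟩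
    antid N (λ l e → P N * (I e * (p ^ tri l * capparelli l)))
      ≈⟨ antid-*ˡ N _ _ ⟩
    P N * antid N (λ l e → I e * (p ^ tri l * capparelli l)) ∎
    where
    g : ℕ → ℕ → ℕ → Carrier
    g n m e = q ^ expL m n * (P N * (Q.I m * (I n * I e)))
    spread-antid : ∀ k x (g : ℕ → ℕ → ℕ → Carrier) →
      spread (λ n → antid k (g n)) x ≈ antid k (λ m e → spread (λ n → g n m e) x)
    spread-antid k zero          g = refl
    spread-antid k (suc zero)    g = sym (antid-0 k)
    spread-antid k (suc (suc x)) g = spread-antid k x (λ n → g (suc n))
    power : ∀ n m → q ^ expL m n ≈ p ^ tri (n ℕ.+ n ℕ.+ m) * q ^ tri m
    power n m = begin
      q ^ expL m n                                         ≡⟨ ≡.cong (q ^_) (expL-tri m n) ⟩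
      q ^ (3 ℕ.* tri (n ℕ.+ n ℕ.+ m) ℕ.+ tri m)            ≈⟨ ^-homo-* q (3 ℕ.* tri (n ℕ.+ n ℕ.+ m)) (tri m) ⟩
      q ^ (3 ℕ.* tri (n ℕ.+ n ℕ.+ m)) * q ^ tri m          ≈⟨ *-congʳ (p^≈q^ (tri (n ℕ.+ n ℕ.+ m))) ⟨
      p ^ tri (n ℕ.+ n ℕ.+ m) * q ^ tri m                  ∎
    1^ : ∀ n → 1# ^ n ≈ 1#
    1^ zero    = refl
    1^ (suc n) = trans (*-identityˡ _) (1^ n)
    term : ∀ l x m e → x ℕ.+ m ≡ l → spread (λ n → g n m e) x ≈ P N * I e * p ^ tri l * (spread (κ 1#) x * Q.E 1# m)
    term _ x m e ≡.refl = begin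
      spread (λ n → g n m e) x
        ≈⟨ spread-cong (λ n → trans (*-congʳ (power n m)) (trans
             (solve 6 (λ t s P J I e → t :* s :* (P :* (J :* (I :* e))) := con 1 :* I :* (P :* e :* t :* (s :* (con 1 :* J)))) refl _ _ _ _ _ _)
             (*-cong (*-congʳ (sym (1^ n))) (*-congˡ (*-congˡ (*-congʳ (sym (1^ m)))))))) x ⟩
      spread (λ n → κ 1# n * (P N * I e * p ^ tri (n ℕ.+ n ℕ.+ m) * Q.E 1# m)) x
        -- The cofactor depends on n only through n + n = x, so it can leave `spread`.
        ≈⟨ spread-*ʳ (κ 1#) (λ x → P N * I e * p ^ tri (x ℕ.+ m) * Q.E 1# m) x ⟨
      spread (κ 1#) x * (P N * I e * p ^ tri (x ℕ.+ m) * Q.E 1# m)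
        ≈⟨ solve 3 (λ k a b → k :* (a :* b) := a :* (k :* b)) refl _ _ _ ⟩
      P N * I e * p ^ tri (x ℕ.+ m) * (spread (κ 1#) x * Q.E 1# m) ∎

-- Power series in q

module _ {c ℓ} (R : CommutativeRing c ℓ) where
  open CommutativeRing R
  open Antidiagonal R

  foldr-applyUpTo : ∀ n (f : ℕ → Carrier) (g : ℕ → ℕ) →
    foldr _+_ 0# (map f (applyUpTo g (suc n))) ≈ antid n (λ i _ → f (g i))
  foldr-applyUpTo zero    f g = +-identityʳ _
  foldr-applyUpTo (suc n) f g = +-congˡ (foldr-applyUpTo n f (g ∘ suc))

open Antidiagonal ℤₚ.+-*-commutativeRing using () renaming (antid-cong to antidℤ-cong)
open PowerSeries ℤₚ.+-*-commutativeRing using (one; _⊛_; one-⊛; seriesRing)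
open Monomials ℤₚ.+-*-commutativeRing using (Y; Y-⊛-suc)
open CommutativeRing seriesRing hiding (zero)
open import Algebra.Properties.Semiring.Exp semiring using (_^_)
open import Relation.Binary.Reasoning.Setoid setoid

⊗≈⊛ : ∀ f g → f ⊗ g ≈ f ⊛ g
⊗≈⊛ f g n = ≡.trans (foldr-applyUpTo ℤₚ.+-*-commutativeRing n (λ i → f i ℤ.* g (n ∸ i)) id)
  (antidℤ-cong n (λ i j i+j≡n → ≡.cong (λ k → f i ℤ.* g k)
    (≡.trans (≡.cong (_∸ i) (≡.sym i+j≡n)) (ℕₚ.m+n∸m≡n i j))))

⊗-cong : ∀ {f f′ g g′} → f ≈ f′ → g ≈ g′ → f ⊗ g ≈ f′ ⊛ g′
⊗-cong {f} {f′} {g} {g′} e e′ = trans {f ⊗ g} (⊗≈⊛ f g) (*-cong {f} {f′} {g} {g′} e e′)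

oneS≈one : oneS ≈ one
oneS≈one zero    = ≡.refl
oneS≈one (suc n) = ≡.refl

qpow≈Y^ : ∀ k → qpow k ≈ Y ^ k
qpow≈Y^ zero    n       = oneS≈one n
qpow≈Y^ (suc k) zero    = ≡.refl
qpow≈Y^ (suc k) (suc n) = ≡.trans (qpow≈Y^ k n) (≡.sym (Y-⊛-suc (Y ^ k) n))

Y^-⊛-< : ∀ k f n → n ℕ.< k → (Y ^ k ⊛ f) n ≡ + 0
Y^-⊛-< (suc k) f zero    _         = ≡.refl
Y^-⊛-< (suc k) f (suc n) (s≤s n<k) = ≡.trans (*-assoc Y (Y ^ k) f (suc n))
  (≡.trans (Y-⊛-suc (Y ^ k ⊛ f) n) (Y^-⊛-< k f n n<k))

Y^-⊛-+ : ∀ k f n → (Y ^ k ⊛ f) (k ℕ.+ n) ≡ f n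
Y^-⊛-+ zero    f n = one-⊛ f n
Y^-⊛-+ (suc k) f n = ≡.trans (*-assoc Y (Y ^ k) f (suc (k ℕ.+ n)))
  (≡.trans (Y-⊛-suc (Y ^ k ⊛ f) (k ℕ.+ n)) (Y^-⊛-+ k f n))

geomInv-∣ : ∀ k n → k ∣ n → geomInv k n ≡ + 1
geomInv-∣ k n k∣n with k ∣? n
... | yes _   = ≡.refl
... | no  k∤n = ⊥-elim (k∤n k∣n)

geomInv-period : ∀ k n → geomInv k (k ℕ.+ n) ≡ geomInv k n
geomInv-period k n with k ∣? n | k ∣? (k ℕ.+ n)
... | yes _   | yes _     = ≡.refl
... | no  _   | no  _     = ≡.refl
... | yes k∣n | no  k∤k+n = ⊥-elim (k∤k+n (∣m∣n⇒∣m+n ∣-refl k∣n))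
... | no  k∤n | yes k∣k+n = ⊥-elim (k∤n (∣m+n∣m⇒∣n k∣k+n ∣-refl))

geomInv-< : ∀ k n → suc n ℕ.< k → geomInv k (suc n) ≡ + 0
geomInv-< k n n<k with k ∣? suc n
... | no  _   = ≡.refl
... | yes k∣n = ⊥-elim (ℕₚ.<⇒≱ n<k (∣⇒≤ k∣n))

-- In degrees up to k the product with Y^(k+1) vanishes and only the constant 1 is left. From degree
-- k+1 on, the product is the coefficient k+1 places earlier, and divisibility by k+1 has that
-- period.
geomInv-eq : GeometricInverses seriesRing Y (geomInv ∘ suc)
geomInv-eq k n with n ℕ.<? suc k
geomInv-eq k zero    | yes _ = geomInv-∣ (suc k) 0 (suc k ∣0)
geomInv-eq k (suc n) | yes n<k = ≡.trans (geomInv-< (suc k) n n<k)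
  (≡.sym (≡.trans (ℤₚ.+-identityˡ _) (Y^-⊛-< (suc k) (geomInv (suc k)) (suc n) n<k)))
... | no n≮k = ≡.subst (λ n → geomInv (suc k) n ≡ one n ℤ.+ (Y ^ suc k ⊛ geomInv (suc k)) n)
  (ℕₚ.m+[n∸m]≡n (ℕₚ.≮⇒≥ n≮k))
  (≡.trans (geomInv-period (suc k) (n ∸ suc k))
    (≡.sym (≡.trans (ℤₚ.+-identityˡ _) (Y^-⊛-+ (suc k) (geomInv (suc k)) (n ∸ suc k)))))

-- The two sides of the theorem over ℤ[[q]], with q the variable `Y` of the series ring over ℤ

open Antidiagonal seriesRing using (antid; antid-cong; antid-*ˡ)
open Monomials seriesRing using (sumTo)
open Cubic seriesRing Y (geomInv ∘ suc) geomInv-eq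
open import Algebra.Solver.Ring.NaturalCoefficients.Default commutativeSemiring
  using (solve; _:=_; _:*_)

qpow³≈p^ : ∀ k → qpow (3 ℕ.* k) ≈ p ^ k
qpow³≈p^ k = trans {qpow (3 ℕ.* k)} (qpow≈Y^ (3 ℕ.* k)) (sym {p ^ k} (p^≈q^ k))

poch≈P : ∀ n → poch 3 n ≈ P n
poch≈P zero    = oneS≈one
poch≈P (suc n) = ⊗-cong {poch 3 n} {P n} {oneS ⊖ₛ qpow (3 ℕ.* suc n)} {1# - p ^ suc n} (poch≈P n)
  (λ k → ≡.cong₂ ℤ._-_ (oneS≈one k) (qpow³≈p^ (suc n) k))

invPoch³≈I : ∀ n → invPochℕ 3 n ≈ I n
invPoch³≈I zero    = oneS≈one
invPoch³≈I (suc n) = ⊗-cong {invPochℕ 3 n} {I n} (invPoch³≈I n) (refl {geomInv (3 ℕ.* suc n)})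

invPoch≈I : ∀ n → invPochℕ 1 n ≈ Q.I n
invPoch≈I zero    = oneS≈one
invPoch≈I (suc n) = ⊗-cong {invPochℕ 1 n} {Q.I n} (invPoch≈I n)
  (λ k → ≡.cong (λ d → geomInv d k) (ℕₚ.*-identityˡ (suc n)))

sumS≈sumTo : ∀ n f → sumS (map f (upTo (suc n))) ≈ sumTo n f
sumS≈sumTo n f = foldr-applyUpTo seriesRing n f id

lower-index : ∀ M m n → + M ℤ.- + (2 ℕ.* n) ℤ.- + m ≡ M ⊖ (n ℕ.+ n ℕ.+ m)
lower-index M m n = ≡.trans (ℤₚ.+-assoc (+ M) (ℤ.- + (2 ℕ.* n)) (ℤ.- + m))
  (≡.trans (≡.cong (ℤ._+_ (+ M)) (≡.sym (ℤₚ.neg-distrib-+ (+ (2 ℕ.* n)) (+ m))))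
  (≡.trans (≡.cong (λ k → + M ℤ.- + (n ℕ.+ k ℕ.+ m)) (ℕₚ.+-identityʳ n)) (ℤₚ.m-n≡m⊖n M (n ℕ.+ n ℕ.+ m))))

lhsTerm-in : ∀ M n m e → n ℕ.+ n ℕ.+ (m ℕ.+ e) ≡ M →
  lhsTerm M m n ≈ Y ^ expL m n * (P M * (Q.I m * (I n * I e)))
lhsTerm-in M n m e eq = begin
  lhsTerm M m n
    ≈⟨ ⊗-cong {_} {_} {invPoch 3 (+ M ℤ.- + (2 ℕ.* n) ℤ.- + m)} {I e}
         (⊗-cong {_} {_} {invPochℕ 3 n} {I n} (⊗-cong {_} {_} {invPochℕ 1 m} {Q.I m}
           (⊗-cong {_} {Y ^ expL m n} {poch 3 M} {P M} (qpow≈Y^ (expL m n)) (poch≈P M)) (invPoch≈I m)) (invPoch³≈I n))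
         (λ k → ≡.trans (≡.cong (λ j → invPoch 3 j k) index) (invPoch³≈I e k)) ⟩
  Y ^ expL m n * P M * Q.I m * I n * I e
    ≈⟨ solve 5 (λ a b c d e → a :* b :* c :* d :* e := a :* (b :* (c :* (d :* e)))) (λ _ → ≡.refl) (Y ^ expL m n) (P M) (Q.I m) (I n) (I e) ⟩
  Y ^ expL m n * (P M * (Q.I m * (I n * I e))) ∎
  where
  index : + M ℤ.- + (2 ℕ.* n) ℤ.- + m ≡ + e
  index = ≡.trans (lower-index M m n) (≡.trans
    (≡.cong₂ _⊖_ (≡.trans (≡.sym eq) (≡.sym (ℕₚ.+-assoc (n ℕ.+ n) m e))) (≡.sym (ℕₚ.+-identityʳ (n ℕ.+ n ℕ.+ m))))
    (ℤₚ.+-cancelˡ-⊖ (n ℕ.+ n ℕ.+ m) e 0))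

⊛-zeroS : ∀ f → f ⊗ zeroS ≈ 0#
⊛-zeroS f = trans {f ⊗ zeroS} (⊗≈⊛ f zeroS) (zeroʳ f)

lhsTerm-out : ∀ M n m → M ℕ.< n ℕ.+ n ℕ.+ m → lhsTerm M m n ≈ 0#
lhsTerm-out M n m M<s k = ≡.trans
  (≡.cong (λ j → (qpow (expL m n) ⊗ poch 3 M ⊗ invPochℕ 1 m ⊗ invPochℕ 3 n ⊗ invPoch 3 j) k) index)
  (⊛-zeroS (qpow (expL m n) ⊗ poch 3 M ⊗ invPochℕ 1 m ⊗ invPochℕ 3 n) k)
  where
  -- `-[1+ d ]` denotes -(d+1), hence `suc M`; a negative index makes the last factor `zeroS`.
  d = n ℕ.+ n ℕ.+ m ∸ suc M
  index : + M ℤ.- + (2 ℕ.* n) ℤ.- + m ≡ ℤ.-[1+ d ]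
  index = ≡.trans (lower-index M m n) (≡.trans (≡.cong₂ _⊖_ (≡.sym (ℕₚ.+-identityʳ M))
    (≡.trans (≡.sym (ℕₚ.m+[n∸m]≡n M<s)) (≡.sym (ℕₚ.+-suc M d)))) (ℤₚ.+-cancelˡ-⊖ M 0 (suc d)))

LHS≈ : ∀ M → LHS M ≈ P M * antid M (λ l e → I e * (p ^ tri l * capparelli l)) * (1# + p ^ M)
LHS≈ M = ⊗-cong {_} {_} {oneS ⊕ qpow (3 ℕ.* M)} {1# + p ^ M}
  (begin
    sumS (map (λ n → sumS (map (λ m → lhsTerm M m n) (upTo (suc M)))) (upTo (suc M)))
      ≈⟨ sumS≈sumTo M (λ n → sumS (map (λ m → lhsTerm M m n) (upTo (suc M)))) ⟩
    sumTo M (λ n → sumS (map (λ m → lhsTerm M m n) (upTo (suc M))))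
      ≈⟨ antid-cong M (λ n _ _ → sumS≈sumTo M (λ m → lhsTerm M m n)) ⟩
    sumTo M (λ n → sumTo M (λ m → lhsTerm M m n))
      ≈⟨ sum-of-products M (λ n m → lhsTerm M m n) (lhsTerm-in M) (lhsTerm-out M) ⟩
    P M * antid M (λ l e → I e * (p ^ tri l * capparelli l)) ∎)
  (λ k → ≡.cong₂ ℤ._+_ (oneS≈one k) (qpow³≈p^ M k))

RHS≈ : ∀ M → T (M ℕ.+ M) (λ i → Y ^ expR (i ⊖ M) + Y ^ expR' (i ⊖ M)) ≈ RHS M
RHS≈ M = begin
  T (M ℕ.+ M) φ
    ≈⟨ T-closed (M ℕ.+ M) φ ⟩
  P (M ℕ.+ M) * antid (M ℕ.+ M) (λ i j → I i * I j * φ i)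
    ≈⟨ antid-*ˡ (M ℕ.+ M) (P (M ℕ.+ M)) (λ i j → I i * I j * φ i) ⟨
  antid (M ℕ.+ M) (λ i j → P (M ℕ.+ M) * (I i * I j * φ i))
    ≈⟨ antid-cong (M ℕ.+ M) (λ i j i+j≡2M → sym {term i} (term≈ i j i+j≡2M)) ⟩
  sumTo (M ℕ.+ M) term
    ≈⟨ sumS≈sumTo (M ℕ.+ M) term ⟨
  sumS (map term (upTo (suc (M ℕ.+ M))))
    -- The range in `RHS` is given by `2 * M`, which unfolds to `M + (M + 0)`.
    ≈⟨ (λ k → ≡.cong (λ n → sumS (map term (upTo (suc (M ℕ.+ n)))) k) (≡.sym (ℕₚ.+-identityʳ M))) ⟩
  RHS M ∎
  where
  φ : ℕ → PS
  φ i = Y ^ expR (i ⊖ M) + Y ^ expR' (i ⊖ M)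
  term : ℕ → PS
  term i = (qpow (expR (i ⊖ M)) ⊕ qpow (expR' (i ⊖ M))) ⊗ gauss 3 (+ M ℤ.+ (i ⊖ M)) (+ M ℤ.- (i ⊖ M))
  upper : ∀ i → + M ℤ.+ (i ⊖ M) ≡ + i
  upper i = ≡.trans (ℤₚ.distribʳ-⊖-+-pos M i M) (≡.trans
    (≡.cong ((M ℕ.+ i) ⊖_) (≡.sym (ℕₚ.+-identityʳ M))) (ℤₚ.+-cancelˡ-⊖ M i 0))
  lower : ∀ i j → i ℕ.+ j ≡ M ℕ.+ M → + M ℤ.- (i ⊖ M) ≡ + j
  lower i j i+j≡2M = ≡.trans (≡.cong (ℤ._+_ (+ M)) (≡.sym (ℤₚ.⊖-swap M i))) (≡.trans (ℤₚ.distribʳ-⊖-+-pos M M i)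
    (≡.trans (≡.cong₂ _⊖_ (≡.sym i+j≡2M) (≡.sym (ℕₚ.+-identityʳ i))) (ℤₚ.+-cancelˡ-⊖ i j 0)))
  term≈ : ∀ i j → i ℕ.+ j ≡ M ℕ.+ M → term i ≈ P (M ℕ.+ M) * (I i * I j * φ i)
  term≈ i j i+j≡2M = begin
    term i
      ≈⟨ ⊗-cong {_} {φ i} {gauss 3 (+ M ℤ.+ (i ⊖ M)) (+ M ℤ.- (i ⊖ M))} {P (M ℕ.+ M) * I i * I j}
           (λ k → ≡.cong₂ ℤ._+_ (qpow≈Y^ (expR (i ⊖ M)) k) (qpow≈Y^ (expR' (i ⊖ M)) k))
           (λ k → ≡.trans (≡.cong₂ (λ x y → gauss 3 x y k) (upper i) (lower i j i+j≡2M))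
             (⊗-cong {_} {P (M ℕ.+ M) * I i} {invPochℕ 3 j} {I j}
               (⊗-cong {poch 3 (i ℕ.+ j)} {P (M ℕ.+ M)} {invPochℕ 3 i} {I i}
                 (λ k → ≡.trans (≡.cong (λ n → poch 3 n k) i+j≡2M) (poch≈P (M ℕ.+ M) k)) (invPoch³≈I i)) (invPoch³≈I j) k)) ⟩
    φ i * (P (M ℕ.+ M) * I i * I j)
      ≈⟨ solve 4 (λ f a b c → f :* (a :* b :* c) := a :* (b :* c :* f)) (λ _ → ≡.refl) (φ i) (P (M ℕ.+ M)) (I i) (I j) ⟩
    P (M ℕ.+ M) * (I i * I j * φ i) ∎

theorem4p5 : (M N : ℕ) → LHS M N ≡ RHS M N
theorem4p5 M N = ≡.trans (LHS≈ M N) (≡.trans (finite-identity M N) (RHS≈ M N))
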